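{- Let $q$ be a prime power, $n\ge1$, $\sigma$ a generator of $\mathrm{Gal}(\mathbb{F}_{q^n}/\mathbb{F}_q)$, and $L=ax+bx^{\sigma}+cx^{\sigma^2}+dx^{\sigma^3}$ with $a,b,c,d\in\mathbb{F}_{q^n}$, $d\neq0$ and $a\neq 0$. Then for each $g\in\{0,1,2,3\}$, $L$ has exactly $q^g$ roots in $\mathbb{F}_{q^n}$ if and only if $1$ is an eigenvalue of $A_L$ with geometric multiplicity $g$ (where geometric multiplicity $0$ means $1$ is not an eigenvalue).
   Context: $C_L=\begin{pmatrix}0&0&-a/d\\1&0&-b/d\\0&1&-c/d\end{pmatrix}$ and $A_L=C_LC_L^{\sigma}\cdots C_L^{\sigma^{n-1}}$, where $C_L^{\sigma^i}$ denotes entrywise application of $\sigma^i$. -}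

module Defs where

open import Level using (Level; _⊔_) renaming (suc to lsuc)
open import Algebra.Bundles using (CommutativeRing)
open import Data.Nat as ℕ using (ℕ; zero; suc)
open import Data.Nat.Primality using (Prime)
open import Data.Fin using (Fin; zero; suc)
open import Data.Product using (Σ; ∃; _×_; _,_; proj₁)
open import Data.List using (List; length)
open import Data.List.Relation.Unary.All using (All)
open import Data.List.Relation.Unary.Any using (Any)
open import Data.List.Relation.Unary.AllPairs using (AllPairs)
open import Relation.Nullary using (¬_)
open import Relation.Binary.PropositionalEquality using (_≡_)

IsPrimePower : ℕ → Set
IsPrimePower q = Σ ℕ λ p → Σ ℕ λ k → Prime p × (q ≡ p ℕ.^ suc k)

record Field (c ℓ : Level) : Set (lsuc (c ⊔ ℓ)) where
  field
    commutativeRing : CommutativeRing c ℓ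
  open CommutativeRing commutativeRing public
  field
    0≉1     : ¬ (0# ≈ 1#)
    _⁻¹     : (x : Carrier) → ¬ (x ≈ 0#) → Carrier
    ⁻¹-inverse : (x : Carrier) (x≉0 : ¬ (x ≈ 0#)) → x * (x ⁻¹) x≉0 ≈ 1#

module FieldDefs {c ℓ : Level} (F : Field c ℓ) where
  open Field F hiding (zero)

  pow : Carrier → ℕ → Carrier
  pow x zero    = 1#
  pow x (suc k) = x * pow x k

  iter : (Carrier → Carrier) → ℕ → Carrier → Carrier
  iter f zero    x = x
  iter f (suc i) x = f (iter f i x)

  HasExactly : ∀ {p} → (Carrier → Set p) → ℕ → Set (c ⊔ ℓ ⊔ p)
  HasExactly P N = Σ (List Carrier) λ xs →
      (length xs ≡ N)
    × AllPairs (λ x y → ¬ (x ≈ y)) xs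
    × All P xs
    × (∀ x → P x → Any (λ y → x ≈ y) xs)

  -- the prime subfield-level copy of F_q inside F = F_{q^n}: {x | x^q = x}
  InFq : ℕ → Carrier → Set ℓ
  InFq q x = pow x q ≈ x

  record IsRingAut (σ : Carrier → Carrier) : Set (c ⊔ ℓ) where
    field
      cong      : ∀ {x y} → x ≈ y → σ x ≈ σ y
      hom-+     : ∀ x y → σ (x + y) ≈ σ x + σ y
      hom-*     : ∀ x y → σ (x * y) ≈ σ x * σ y
      hom-1     : σ 1# ≈ 1#
      injective : ∀ {x y} → σ x ≈ σ y → x ≈ y
      surjective : ∀ y → ∃ λ x → σ x ≈ y

  record InGal (q : ℕ) (τ : Carrier → Carrier) : Set (c ⊔ ℓ) where
    field
      aut   : IsRingAut τ
      fixes : ∀ x → InFq q x → τ x ≈ x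

  record IsGalGenerator (q : ℕ) (σ : Carrier → Carrier) : Set (lsuc (c ⊔ ℓ)) where
    field
      inGal    : InGal q σ
      generates : (τ : Carrier → Carrier) → InGal q τ →
                  ∃ λ (i : ℕ) → ∀ x → τ x ≈ iter σ i x

  Lpoly : (σ : Carrier → Carrier) (a b c' d : Carrier) → Carrier → Carrier
  Lpoly σ a b c' d x = a * x + b * σ x + c' * iter σ 2 x + d * iter σ 3 x

  Mat : Set c
  Mat = Fin 3 → Fin 3 → Carrier

  Vec3 : Set c
  Vec3 = Fin 3 → Carrier

  sum3 : (Fin 3 → Carrier) → Carrier
  sum3 f = f zero + f (suc zero) + f (suc (suc zero))

  _⊗_ : Mat → Mat → Mat
  (M ⊗ N) i j = sum3 (λ k → M i k * N k j)

  I₃ : Mat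
  I₃ zero zero = 1#
  I₃ (suc zero) (suc zero) = 1#
  I₃ (suc (suc zero)) (suc (suc zero)) = 1#
  I₃ _ _ = 0#

  mapMat : (Carrier → Carrier) → Mat → Mat
  mapMat f M i j = f (M i j)

  C-L : (a b c' d : Carrier) → ¬ (d ≈ 0#) → Mat
  C-L a b c' d d≉0 = M
    where
      d⁻ = (d ⁻¹) d≉0
      M : Mat
      M zero zero = 0#
      M zero (suc zero) = 0#
      M zero (suc (suc zero)) = - (a * d⁻)
      M (suc zero) zero = 1#
      M (suc zero) (suc zero) = 0#
      M (suc zero) (suc (suc zero)) = - (b * d⁻)
      M (suc (suc zero)) zero = 0#
      M (suc (suc zero)) (suc zero) = 1#
      M (suc (suc zero)) (suc (suc zero)) = - (c' * d⁻)

  prodFrom : (σ : Carrier → Carrier) → Mat → ℕ → ℕ → Mat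
  prodFrom σ C i zero    = I₃
  prodFrom σ C i (suc k) = mapMat (iter σ i) C ⊗ prodFrom σ C (suc i) k

  A-L : (σ : Carrier → Carrier) (n : ℕ) (a b c' d : Carrier) → ¬ (d ≈ 0#) → Mat
  A-L σ n a b c' d d≉0 = prodFrom σ (C-L a b c' d d≉0) 0 n

  apply : Mat → Vec3 → Vec3
  apply M v i = sum3 (λ k → M i k * v k)

  _≈v_ : Vec3 → Vec3 → Set ℓ
  v ≈v w = ∀ i → v i ≈ w i

  0v : Vec3
  0v _ = 0#

  lincomb : ∀ g → (Fin g → Carrier) → (Fin g → Vec3) → Vec3
  lincomb zero    λs vs k = 0#
  lincomb (suc g) λs vs k = λs zero * vs zero k + lincomb g (λ i → λs (suc i)) (λ i → vs (suc i)) k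

  InEig1 : Mat → Vec3 → Set ℓ
  InEig1 M v = apply M v ≈v v

  -- 1 is an eigenvalue of M with geometric multiplicity g, i.e. the
  -- eigenspace {v | M v = v} has dimension g (it has a basis of g vectors).
  -- For g = 0 this says the eigenspace is {0}, i.e. 1 is not an eigenvalue.
  GeomMult1 : Mat → ℕ → Set (c ⊔ ℓ)
  GeomMult1 M g = Σ (Fin g → Vec3) λ vs →
      (∀ i → InEig1 M (vs i))
    × (∀ (λs : Fin g → Carrier) → lincomb g λs vs ≈v 0v → ∀ i → λs i ≈ 0#)
    × (∀ v → InEig1 M v → ∃ λ (λs : Fin g → Carrier) → v ≈v lincomb g λs vs)

-- Put Ψ(w) = σ⁻¹(w C_L) on row vectors. Then w A_L = σⁿ(Ψⁿ w), and w = Ψ w holds exactly when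
-- w = (x, σ x, σ² x) for a root x of L. Since σⁿ = 1, the left eigenspace of A_L for the
-- eigenvalue 1 is {w | Ψⁿ w = w}, and Ψ is a σ⁻¹-semilinear operator of period n on it, so by
-- Galois descent its dimension over F_{q^n} is the dimension over F_q of the space of roots. Left
-- and right eigenspaces have the same dimension, by counting the two kernels of A_L − 1.
--
-- That [F : Fix σ] = n and σⁿ = 1 rests on one bound: a nonzero skew polynomial Σ cᵢ τⁱ with m
-- coefficients does not vanish at m elements independent over Fix τ. Applied to the Frobenius
-- automorphism it also gives |F_q| ≥ q; the number of roots of x^q − x gives |F_q| ≤ q.
module Submission where

open import Defs
open import Level using (Level; _⊔_; 0ℓ)
open import Algebra.Bundles using (CommutativeRing; RawRing)
open import Algebra.Solver.Ring.AlmostCommutativeRing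
  using (fromCommutativeRing; _-Raw-AlmostCommutative⟶_; -raw-almostCommutative⟶)
open import Data.Empty using (⊥-elim)
open import Data.Fin as Fin using (Fin; zero; suc; toℕ)
open import Data.Fin.Permutation using (↔⇒≡)
import Data.Fin.Properties as Finₚ
open import Data.Maybe using (Maybe; just; nothing)
open import Data.Nat as ℕ using (ℕ; zero; suc; z≤n; s≤s)
open import Data.Nat.GeneralisedArithmetic using (fold)
import Data.Nat.Properties as ℕₚ
open import Data.Product using (Σ; ∃; _×_; _,_; proj₁; proj₂)
open import Data.Product.Function.NonDependent.Setoid using (_×-inverse_)
open import Data.Product.Relation.Binary.Pointwise.NonDependent using (×-setoid; Pointwise-≡↔≡)
open import Data.Sum using (inj₁; inj₂)
open import Data.Unit.Polymorphic using (⊤; tt)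
open import Data.Vec.Functional using (_∷_; replicate)
open import Data.Vec.Functional.Relation.Binary.Equality.Setoid using (≋-setoid)
open import Function using (_∘_)
open import Function.Bundles using (Inverse; _⇔_; mk⇔)
import Function.Construct.Composition as Comp
import Function.Construct.Symmetry as Symm
open import Relation.Binary.Bundles using (Setoid)
import Relation.Binary.Construct.On as On
open import Relation.Binary.Definitions using (Decidable; tri<; tri≈; tri>)
open import Relation.Binary.PropositionalEquality as ≡ using (_≡_)
open import Relation.Nullary using (¬_; Dec; yes; no)
open import Relation.Nullary.Decidable using (map′; ¬?; _×-dec_; decidable-stable)

-- Dimensions are compared through cardinalities: a space of dimension r over a field with s
-- elements has s ^ r elements, and s ^ r determines r once s > 1. Finiteness also decides by search
-- the predicates that matter, so bases and pivots can be chosen constructively.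
--
-- The obstacle is that σ is given only as a generator; neither its order nor the size of its fixed
-- field is known beforehand. Being a generator makes Frobenius a power of σ, so Fix σ = F_q. This
-- has q elements, and q ^ m = q ^ n forces the degree m of F over Fix σ to be n. For the order, the
-- maps 1, σ, ..., σᵐ⁻¹ interpolate any values on a basis, so σᵐ is a combination of them. Comparing
-- this relation at yx and at x makes σᵐ equal to some σⁱ with i < m, and the bound on independent
-- roots leaves only i = 0.
--
-- Row vectors are used because the leftmost factor of A_L is C_L itself: a row meets the factors in
-- the order in which their twists increase, so each step is one application of Ψ followed by one
-- more σ. This is why left eigenvectors appear first and a passage to right ones is needed at the
-- end.

private variable a ℓ a′ ℓ′ p p′ : Level

-- Setoids of finite cardinality

_HasSize_ : Setoid a ℓ → ℕ → Set (a ⊔ ℓ)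
S HasSize m = Inverse S (≡.setoid (Fin m))

-- Equality forgets the proof of `P`, so the size counts elements up to the equality of `S`, not
-- pairs of an element and a proof.
Restrict : (S : Setoid a ℓ) → (Setoid.Carrier S → Set p) → Setoid (a ⊔ p) ℓ
Restrict S P = On.setoid {B = Σ (Setoid.Carrier S) P} S proj₁

_∘↔_ : ∀ {a b c ℓ₁ ℓ₂ ℓ₃} {S : Setoid a ℓ₁} {T : Setoid b ℓ₂} {U : Setoid c ℓ₃} →
       Inverse S T → Inverse T U → Inverse S U
_∘↔_ = Comp.inverse

mkInverse : {S : Setoid a ℓ} {T : Setoid a′ ℓ′} → let open Setoid in
            (to : Carrier S → Carrier T) (from : Carrier T → Carrier S) →
            (∀ {x y} → _≈_ S x y → _≈_ T (to x) (to y)) →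
            (∀ {x y} → _≈_ T x y → _≈_ S (from x) (from y)) →
            (∀ x → _≈_ T (to (from x)) x) → (∀ x → _≈_ S (from (to x)) x) → Inverse S T
mkInverse {S = S} {T} to from to-cong from-cong to∘from from∘to = record
  { to = to ; from = from ; to-cong = to-cong ; from-cong = from-cong
  ; inverse = (λ {x} eq → T.trans (to-cong eq) (to∘from x))
            , (λ {x} eq → S.trans (from-cong eq) (from∘to x)) }
  where module S = Setoid S; module T = Setoid T

size-unique : ∀ {m n} {S : Setoid a ℓ} → S HasSize m → S HasSize n → m ≡ n
size-unique I J = ↔⇒≡ (Symm.inverse I ∘↔ J)

×-size : ∀ {m n} {S : Setoid a ℓ} {T : Setoid a′ ℓ′} →
         S HasSize m → T HasSize n → (×-setoid S T) HasSize (m ℕ.* n)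
×-size I J = ((I ×-inverse J) ∘↔ Pointwise-≡↔≡) ∘↔ Symm.inverse Finₚ.*↔×

vector-size : ∀ {m} {S : Setoid a ℓ} → S HasSize m → ∀ n → (≋-setoid S n) HasSize (m ℕ.^ n)
vector-size {S = S} I zero = mkInverse {S = ≋-setoid S 0} (λ _ → zero) (λ _ ())
  (λ _ → ≡.refl) (λ _ ()) (λ { zero → ≡.refl ; (suc ()) }) (λ _ ())
vector-size {S = S} I (suc n) = split ∘↔ ×-size I (vector-size I n)
  where
  open Setoid S
  split : Inverse (≋-setoid S (suc n)) (×-setoid S (≋-setoid S n))
  split = mkInverse (λ f → f zero , f ∘ suc) (λ { (x , f) zero → x ; (x , f) (suc i) → f i })
    (λ eq → eq zero , eq ∘ suc) (λ { (eq , eqs) zero → eq ; (eq , eqs) (suc i) → eqs i })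
    (λ _ → refl , λ _ → refl) (λ { f zero → refl ; f (suc i) → refl })

module _ {m} {S : Setoid a ℓ} (I : S HasSize m) where
  open Setoid S
  open Inverse I

  infix 4 _≈?_
  _≈?_ : Decidable _≈_
  x ≈? y = map′ (λ eq → trans (sym (strictlyInverseʳ x))
                              (trans (from-cong eq) (strictlyInverseʳ y)))
                to-cong (to x Finₚ.≟ to y)

  -- Finiteness stands in for excluded middle: a predicate that respects equality need only be
  -- tested at the `m` representatives `from i`.
  search : {P : Carrier → Set p} → (∀ {x y} → x ≈ y → P x → P y) → (∀ x → Dec (P x)) → Dec (∃ P)
  search resp P? = map′ (λ { (i , q) → from i , q })
    (λ { (x , q) → to x , resp (sym (strictlyInverseʳ x)) q })
    (Finₚ.any? (P? ∘ from))

Fin-subset-size : ∀ {m} {P : Fin m → Set p} → (∀ i → Dec (P i)) →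
                  ∃ λ k → Restrict (≡.setoid (Fin m)) P HasSize k
Fin-subset-size {m = zero} P? = 0 , mkInverse (λ { (() , _) }) (λ ()) (λ { {() , _} }) (λ { {()} })
  (λ ()) (λ { (() , _) })
Fin-subset-size {m = suc m} {P} P? with Fin-subset-size (P? ∘ suc) | P? zero
... | k , I | yes p₀ = suc k , mkInverse
  (λ { (zero , _) → zero ; (suc i , p) → suc (to (i , p)) })
  (λ { zero → zero , p₀ ; (suc j) → let (i , p) = from j in suc i , p })
  (λ { {zero , _} {zero , _} _ → ≡.refl
     ; {suc i , p} {suc j , q} eq → ≡.cong suc (to-cong (Finₚ.suc-injective eq)) })
  (λ { ≡.refl → ≡.refl })
  (λ { zero → ≡.refl ; (suc j) → ≡.cong suc (strictlyInverseˡ j) })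
  (λ { (zero , _) → ≡.refl ; (suc i , p) → ≡.cong suc (strictlyInverseʳ (i , p)) })
  where open Inverse I
... | k , I | no ¬p₀ = k , mkInverse
  (λ { (zero , p) → ⊥-elim (¬p₀ p) ; (suc i , p) → to (i , p) })
  (λ j → let (i , p) = from j in suc i , p)
  (λ { {zero , p} {_} _ → ⊥-elim (¬p₀ p)
     ; {suc i , p} {zero , q} _ → ⊥-elim (¬p₀ q)
     ; {suc i , p} {suc j , q} eq → to-cong (Finₚ.suc-injective eq) })
  (λ { ≡.refl → ≡.refl })
  (λ j → strictlyInverseˡ j)
  (λ { (zero , p) → ⊥-elim (¬p₀ p) ; (suc i , p) → ≡.cong suc (strictlyInverseʳ (i , p)) })
  where open Inverse I

subset-size : ∀ {m} {S : Setoid a ℓ} → S HasSize m → {P : Setoid.Carrier S → Set p} →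
              (∀ {x y} → Setoid._≈_ S x y → P x → P y) → (∀ x → Dec (P x)) →
              ∃ λ k → Restrict S P HasSize k
subset-size {S = S} I {P} resp P? =
  let (k , J) = Fin-subset-size {P = P ∘ from} (P? ∘ from) in
  k , (mkInverse {S = Restrict S P} {T = Restrict (≡.setoid (Fin _)) (P ∘ from)}
         (λ { (x , p) → to x , resp (sym (strictlyInverseʳ x)) p })
         (λ { (i , p) → from i , p })
         to-cong from-cong
         (λ { (i , _) → strictlyInverseˡ i })
         (λ { (x , _) → strictlyInverseʳ x })
       ∘↔ J)
  where
  open Setoid S
  open Inverse I

-- Exact counts by lists and by bijections

module _ {c ℓ} (F : Field c ℓ) where
  open Field F
  open FieldDefs F using (HasExactly)
  open import Data.List as List using (List; length; tabulate; lookup)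
  import Data.List.Properties as Listₚ
  open import Data.List.Relation.Unary.All as All using (All)
  import Data.List.Relation.Unary.All.Properties as Allₚ
  open import Data.List.Membership.Propositional.Properties using (∈-lookup)
  open import Data.List.Relation.Unary.Any as Any using (Any)
  import Data.List.Relation.Unary.Any.Properties as Anyₚ
  open import Data.List.Relation.Unary.AllPairs as AllPairs using (AllPairs)
  import Data.List.Relation.Unary.AllPairs.Properties as AllPairsₚ

  lookup-All : ∀ {P : Carrier → Set p} {xs : List Carrier} → All P xs → ∀ i → P (lookup xs i)
  lookup-All ps i = All.lookup ps (∈-lookup i)

  lookup-distinct : {xs : List Carrier} → AllPairs (λ x y → ¬ (x ≈ y)) xs →
                    ∀ {i j} → lookup xs i ≈ lookup xs j → i ≡ j
  lookup-distinct (_ AllPairs.∷ _) {zero} {zero} _ = ≡.refl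
  lookup-distinct (h AllPairs.∷ _) {zero} {suc j} eq = ⊥-elim (lookup-All h j eq)
  lookup-distinct (h AllPairs.∷ _) {suc i} {zero} eq = ⊥-elim (lookup-All h i (sym eq))
  lookup-distinct (_ AllPairs.∷ hs) {suc i} {suc j} eq = ≡.cong suc (lookup-distinct hs eq)

  HasExactly⇒size : ∀ {P : Carrier → Set p} {N} → HasExactly P N → Restrict setoid P HasSize N
  HasExactly⇒size {P = P} (xs , ≡.refl , distinct , sound , complete) = mkInverse
    (λ { (x , px) → position x px })
    (λ i → lookup xs i , lookup-All sound i)
    (λ { {x , px} {y , py} eq → lookup-distinct distinct
           (trans (sym (at-position x px)) (trans eq (at-position y py))) })
    (λ { ≡.refl → refl })
    (λ i → lookup-distinct distinct (sym (at-position (lookup xs i) (lookup-All sound i))))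
    (λ { (x , px) → sym (at-position x px) })
    where
    position : ∀ x → P x → Fin (length xs)
    position x px = Any.index (complete x px)
    at-position : ∀ x px → x ≈ lookup xs (position x px)
    at-position x px = Anyₚ.lookup-index (complete x px)

  size⇒HasExactly : ∀ {P : Carrier → Set p} {N} → Restrict setoid P HasSize N → HasExactly P N
  size⇒HasExactly I = tabulate (proj₁ ∘ from) , Listₚ.length-tabulate _
    , AllPairsₚ.tabulate⁺ (λ {i} {j} i≢j eq → i≢j (≡.trans (≡.sym (strictlyInverseˡ i))
        (≡.trans (to-cong eq) (strictlyInverseˡ j))))
    , Allₚ.tabulate⁺ (proj₂ ∘ from)
    , λ x px → Anyₚ.tabulate⁺ (to (x , px)) (sym (strictlyInverseʳ (x , px)))
    where open Inverse I

-- Ring equations with integer coefficients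

module RingSolver {c ℓ} (R : CommutativeRing c ℓ) where
  open CommutativeRing R
  open import Algebra.Properties.Semiring.Mult semiring
    using (×1-homo-*; ×-homo-+; ×-congˡ) renaming (_×_ to _·_)
  open import Algebra.Properties.Ring ring using (-‿distribˡ-*; -‿distribʳ-*; -0#≈0#; -‿involutive)
  open import Algebra.Properties.AbelianGroup +-abelianGroup using (⁻¹-anti-homo‿-)
  open import Relation.Binary.Reasoning.Setoid setoid
  -- A bootstrap solver whose coefficients are never recognised as equal. It is enough for the
  -- identities that justify the integer coefficients of the solver exported below.
  import Algebra.Solver.Ring rawRing (fromCommutativeRing R)
    (-raw-almostCommutative⟶ (fromCommutativeRing R)) (λ _ _ → nothing) as Formal

  -- The pair (m , n) stands for the integer m − n.
  differences : RawRing _ _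
  differences = record
    { Carrier = ℕ × ℕ ; _≈_ = _≡_
    ; _+_ = λ { (m , n) (m′ , n′) → m ℕ.+ m′ , n ℕ.+ n′ }
    ; _*_ = λ { (m , n) (m′ , n′) → m ℕ.* m′ ℕ.+ n ℕ.* n′ , m ℕ.* n′ ℕ.+ n ℕ.* m′ }
    ; -_ = λ { (m , n) → n , m } ; 0# = 0 , 0 ; 1# = 1 , 0 }

  ⟦_⟧ᵈ : ℕ × ℕ → Carrier
  ⟦ m , n ⟧ᵈ = m · 1# - n · 1#

  private
    products : ∀ m n m′ n′ → (m ℕ.* m′ ℕ.+ n ℕ.* n′) · 1# ≈ m · 1# * m′ · 1# + n · 1# * n′ · 1#
    products m n m′ n′ = trans (×-homo-+ 1# (m ℕ.* m′) (n ℕ.* n′))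
                               (+-cong (×1-homo-* m m′) (×1-homo-* n n′))

    expand : ∀ a b c d → (a - b) * (c - d) ≈ (a * c + b * d) - (a * d + b * c)
    expand a b c d = begin
      (a - b) * (c - d)
        ≈⟨ trans (distribʳ _ _ _) (+-cong (distribˡ _ _ _) (distribˡ _ _ _)) ⟩
      (a * c + a * - d) + (- b * c + - b * - d)
        ≈⟨ +-cong (+-congˡ (sym (-‿distribʳ-* a d)))
                  (+-cong (sym (-‿distribˡ-* b c)) (trans (sym (-‿distribˡ-* b (- d)))
                     (trans (-‿cong (sym (-‿distribʳ-* b d))) (-‿involutive (b * d))))) ⟩
      (a * c - a * d) + (- (b * c) + b * d)
        ≈⟨ solve 4 (λ p q r s → (p :- q) :+ (:- r :+ s) := (p :+ s) :- (q :+ r)) refl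
             (a * c) (a * d) (b * c) (b * d) ⟩
      (a * c + b * d) - (a * d + b * c) ∎
      where open Formal

  -- Values 0 and 1 are literal, so that goals mentioning 0# and 1# match up to reduction.
  value : ℕ × ℕ → Carrier
  value (0 , 0) = 0#
  value (1 , 0) = 1#
  value z       = ⟦ z ⟧ᵈ

  value-≈ : ∀ z → value z ≈ ⟦ z ⟧ᵈ
  value-≈ (0 , 0)           = sym (-‿inverseʳ 0#)
  value-≈ (1 , 0)           = sym (trans (+-cong (+-identityʳ 1#) -0#≈0#) (+-identityʳ 1#))
  value-≈ (0 , suc _)       = refl
  value-≈ (1 , suc _)       = refl
  value-≈ (suc (suc _) , _) = refl

  homomorphism : differences -Raw-AlmostCommutative⟶ fromCommutativeRing R
  homomorphism = record
    { ⟦_⟧ = value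
    ; +-homo = λ { x@(m , n) y@(m′ , n′) → begin
        value (m ℕ.+ m′ , n ℕ.+ n′)        ≈⟨ value-≈ (m ℕ.+ m′ , n ℕ.+ n′) ⟩
        (m ℕ.+ m′) · 1# - (n ℕ.+ n′) · 1#
          ≈⟨ +-cong (×-homo-+ 1# m m′) (-‿cong (×-homo-+ 1# n n′)) ⟩
        (m · 1# + m′ · 1#) - (n · 1# + n′ · 1#)
          ≈⟨ solve 4 (λ a b c d → (a :+ c) :- (b :+ d) := (a :- b) :+ (c :- d)) refl
               (m · 1#) (n · 1#) (m′ · 1#) (n′ · 1#) ⟩
        ⟦ x ⟧ᵈ + ⟦ y ⟧ᵈ                    ≈⟨ +-cong (value-≈ x) (value-≈ y) ⟨
        value x + value y                  ∎ }
    ; *-homo = λ { x@(m , n) y@(m′ , n′) → begin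
        value (m ℕ.* m′ ℕ.+ n ℕ.* n′ , m ℕ.* n′ ℕ.+ n ℕ.* m′)
          ≈⟨ value-≈ (m ℕ.* m′ ℕ.+ n ℕ.* n′ , m ℕ.* n′ ℕ.+ n ℕ.* m′) ⟩
        (m ℕ.* m′ ℕ.+ n ℕ.* n′) · 1# - (m ℕ.* n′ ℕ.+ n ℕ.* m′) · 1#
          ≈⟨ +-cong (products m n m′ n′) (-‿cong (products m n n′ m′)) ⟩
        (m · 1# * m′ · 1# + n · 1# * n′ · 1#) - (m · 1# * n′ · 1# + n · 1# * m′ · 1#)
          ≈⟨ expand (m · 1#) (n · 1#) (m′ · 1#) (n′ · 1#) ⟨
        ⟦ x ⟧ᵈ * ⟦ y ⟧ᵈ                    ≈⟨ *-cong (value-≈ x) (value-≈ y) ⟨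
        value x * value y                  ∎ }
    ; -‿homo = λ { x@(m , n) → begin
        value (n , m)    ≈⟨ value-≈ (n , m) ⟩
        n · 1# - m · 1#  ≈⟨ ⁻¹-anti-homo‿- (m · 1#) (n · 1#) ⟨
        - ⟦ x ⟧ᵈ         ≈⟨ -‿cong (value-≈ x) ⟨
        - value x        ∎ }
    ; 0-homo = refl
    ; 1-homo = refl
    }
    where open Formal

  -- The integers m - n and m′ - n′ are compared as m + n′ and m′ + n in ℕ. Different pairs for the
  -- same integer, which arise when terms cancel, are thereby identified.
  weaklyDecided : ∀ x y → Maybe (value x ≈ value y)
  weaklyDecided (m , n) (m′ , n′) with m ℕ.+ n′ ℕ.≟ m′ ℕ.+ n
  ... | no _ = nothing
  ... | yes eq = just (begin
    value (m , n)                          ≈⟨ value-≈ (m , n) ⟩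
    m · 1# - n · 1#                        ≈⟨ +-identityʳ _ ⟨
    m · 1# - n · 1# + 0#                   ≈⟨ +-congˡ (-‿inverseʳ (n′ · 1#)) ⟨
    m · 1# - n · 1# + (n′ · 1# - n′ · 1#)
      ≈⟨ solve 3 (λ a b c → (a :- b) :+ (c :- c) := ((a :+ c) :- b) :- c)
           refl (m · 1#) (n · 1#) (n′ · 1#) ⟩
    ((m · 1# + n′ · 1#) - n · 1#) - n′ · 1#
      ≈⟨ +-congʳ (+-congʳ (trans (sym (×-homo-+ 1# m n′)) (trans (×-congˡ eq) (×-homo-+ 1# m′ n)))) ⟩
    ((m′ · 1# + n · 1#) - n · 1#) - n′ · 1#
      ≈⟨ solve 3 (λ a b c → ((a :+ b) :- b) :- c := (a :- c) :+ (b :- b))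
           refl (m′ · 1#) (n · 1#) (n′ · 1#) ⟩
    m′ · 1# - n′ · 1# + (n · 1# - n · 1#)  ≈⟨ +-congˡ (-‿inverseʳ (n · 1#)) ⟩
    m′ · 1# - n′ · 1# + 0#                 ≈⟨ +-identityʳ _ ⟩
    m′ · 1# - n′ · 1#                      ≈⟨ value-≈ (m′ , n′) ⟨
    value (m′ , n′)                        ∎)
    where open Formal

  open import Algebra.Solver.Ring differences (fromCommutativeRing R) homomorphism weaklyDecided public
    using (Polynomial; con; solve; _:=_; _:+_; _:*_; _:-_; :-_)

  :0 :1 : ∀ {n} → Polynomial n
  :0 = con (0 , 0)
  :1 = con (1 , 0)

-- Linear algebra over a finite field

module FieldProperties {c ℓ} (F : Field c ℓ) where
  open Field F hiding (zero)
  open import Algebra.Properties.Semiring.Sum semiring public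
  open import Relation.Binary.Reasoning.Setoid setoid
  open RingSolver commutativeRing
  private variable d m n r : ℕ

  *-cancel-≉0 : ∀ {x y} → ¬ (x ≈ 0#) → x * y ≈ 0# → y ≈ 0#
  *-cancel-≉0 {x} {y} x≉0 xy≈0 = begin
    y                      ≈⟨ *-identityˡ y ⟨
    1# * y                 ≈⟨ *-congʳ (trans (*-comm _ _) (⁻¹-inverse x x≉0)) ⟨
    ((x ⁻¹) x≉0 * x) * y   ≈⟨ *-assoc _ _ _ ⟩
    (x ⁻¹) x≉0 * (x * y)   ≈⟨ *-congˡ xy≈0 ⟩
    (x ⁻¹) x≉0 * 0#        ≈⟨ zeroʳ _ ⟩
    0#                     ∎

  -≈0⇒≈ : ∀ {x y} → x - y ≈ 0# → x ≈ y
  -≈0⇒≈ {x} {y} eq = begin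
    x            ≈⟨ solve 2 (λ x y → x := (x :- y) :+ y) refl x y ⟩
    (x - y) + y  ≈⟨ +-congʳ eq ⟩
    0# + y       ≈⟨ +-identityˡ y ⟩
    y            ∎

  ≈⇒-≈0 : ∀ {x y} → x ≈ y → x - y ≈ 0#
  ≈⇒-≈0 {x} {y} eq = trans (+-congʳ eq) (-‿inverseʳ y)

  dot : (Fin n → Carrier) → (Fin n → Carrier) → Carrier
  dot f g = sum (λ i → f i * g i)

  unit : Fin n → Fin n → Carrier
  unit {suc n} zero    = 1# ∷ λ _ → 0#
  unit {suc n} (suc i) = 0# ∷ unit i

  sum-zero : {f : Fin n → Carrier} → (∀ i → f i ≈ 0#) → sum f ≈ 0#
  sum-zero {n} f≈0 = trans (sum-cong-≋ f≈0) (sum-replicate-zero n)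

  dot-zeroˡ : {f g : Fin n → Carrier} → (∀ i → f i ≈ 0#) → dot f g ≈ 0#
  dot-zeroˡ f≈0 = sum-zero (λ i → trans (*-congʳ (f≈0 i)) (zeroˡ _))

  dot-congˡ : {f g h : Fin n → Carrier} → (∀ i → g i ≈ h i) → dot f g ≈ dot f h
  dot-congˡ g≈h = sum-cong-≋ (λ i → *-congˡ (g≈h i))

  dot-congʳ : {f g h : Fin n → Carrier} → (∀ i → f i ≈ g i) → dot f h ≈ dot g h
  dot-congʳ f≈g = sum-cong-≋ (λ i → *-congʳ (f≈g i))

  dot-unit : (i : Fin n) (f : Fin n → Carrier) → dot (unit i) f ≈ f i
  dot-unit {suc n} zero f =
    trans (+-cong (*-identityˡ _) (sum-zero (λ i → zeroˡ (f (suc i))))) (+-identityʳ _)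
  dot-unit {suc n} (suc i) f = trans (+-cong (zeroˡ _) (dot-unit i (f ∘ suc))) (+-identityˡ _)

  dot-+ʳ : (f g h : Fin n → Carrier) → dot f (λ i → g i + h i) ≈ dot f g + dot f h
  dot-+ʳ f g h = trans (sum-cong-≋ (λ i → distribˡ (f i) (g i) (h i)))
    (∑-distrib-+ (λ i → f i * g i) (λ i → f i * h i))

  dot-+ˡ : (f g h : Fin n → Carrier) → dot (λ i → f i + g i) h ≈ dot f h + dot g h
  dot-+ˡ f g h = trans (sum-cong-≋ (λ i → distribʳ (h i) (f i) (g i)))
    (∑-distrib-+ (λ i → f i * h i) (λ i → g i * h i))

  dot-*ˡ : ∀ t (f g : Fin n → Carrier) → dot (λ i → t * f i) g ≈ t * dot f g
  dot-*ˡ t f g = trans (sum-cong-≋ (λ i → *-assoc t (f i) (g i))) (sym (*-distribˡ-sum t (λ i → f i * g i)))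

  dot-*ʳ : ∀ t (f g : Fin n → Carrier) → dot f (λ i → t * g i) ≈ t * dot f g
  dot-*ʳ t f g = trans (sum-cong-≋ (λ i → solve 3 (λ f t g → f :* (t :* g) := t :* (f :* g)) refl
    (f i) t (g i))) (sym (*-distribˡ-sum t (λ i → f i * g i)))

  dot-neg : (f g : Fin n → Carrier) → dot f (λ i → - g i) ≈ - dot f g
  dot-neg {zero} f g = solve 0 (:0 := :- :0) refl
  dot-neg {suc n} f g = trans (+-congˡ (dot-neg (f ∘ suc) (g ∘ suc)))
    (solve 3 (λ f g s → f :* (:- g) :+ :- s := :- (f :* g :+ s)) refl (f zero) (g zero) _)

  dot-minusʳ : (f g h : Fin n → Carrier) → dot f (λ i → g i - h i) ≈ dot f g - dot f h
  dot-minusʳ f g h = trans (dot-+ʳ f g (λ i → - h i)) (+-congˡ (dot-neg f h))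

  dot-comm : (f g : Fin n → Carrier) → dot f g ≈ dot g f
  dot-comm f g = sum-cong-≋ (λ i → *-comm (f i) (g i))

  dot-minusˡ : (f g h : Fin n → Carrier) → dot (λ i → f i - g i) h ≈ dot f h - dot g h
  dot-minusˡ f g h = trans (dot-comm (λ i → f i - g i) h)
    (trans (dot-minusʳ h f g) (+-cong (dot-comm h f) (-‿cong (dot-comm h g))))

  dot-dot : (f : Fin m → Carrier) (M : Fin m → Fin n → Carrier) (g : Fin n → Carrier) →
            dot f (λ i → dot (M i) g) ≈ dot (λ j → dot f (λ i → M i j)) g
  dot-dot f M g = begin
    sum (λ i → f i * sum (λ j → M i j * g j))
      ≈⟨ sum-cong-≋ (λ i → *-distribˡ-sum (f i) (λ j → M i j * g j)) ⟩
    sum (λ i → sum (λ j → f i * (M i j * g j)))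
      ≈⟨ ∑-comm (λ i j → f i * (M i j * g j)) ⟩
    sum (λ j → sum (λ i → f i * (M i j * g j)))
      ≈⟨ sum-cong-≋ (λ j → trans (sum-cong-≋ (λ i → sym (*-assoc (f i) (M i j) (g j))))
                                  (sym (*-distribʳ-sum (g j) (λ i → f i * M i j)))) ⟩
    sum (λ j → sum (λ i → f i * M i j) * g j) ∎

  record IsSubfield (S : Carrier → Set p) : Set (c ⊔ ℓ ⊔ p) where
    field
      resp : ∀ {x y} → x ≈ y → S x → S y
      0∈   : S 0#
      1∈   : S 1#
      +∈   : ∀ {x y} → S x → S y → S (x + y)
      *∈   : ∀ {x y} → S x → S y → S (x * y)
      -∈   : ∀ {x} → S x → S (- x)
      ⁻¹∈  : ∀ {x} (x≉0 : ¬ (x ≈ 0#)) → S x → S ((x ⁻¹) x≉0)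

    unit∈ : (i j : Fin n) → S (unit i j)
    unit∈ {suc n} zero zero = 1∈
    unit∈ {suc n} zero (suc j) = 0∈
    unit∈ {suc n} (suc i) zero = 0∈
    unit∈ {suc n} (suc i) (suc j) = unit∈ i j

  everything-isSubfield : IsSubfield {0ℓ} (λ _ → ⊤)
  everything-isSubfield = record
    { resp = λ _ _ → tt ; 0∈ = tt ; 1∈ = tt ; +∈ = λ _ _ → tt ; *∈ = λ _ _ → tt
    ; -∈ = λ _ → tt ; ⁻¹∈ = λ _ _ → tt }

  module _ (S : Carrier → Set p) where

    -- Vectors have entries in F, while coefficients are confined to `S`. The same notions thus
    -- serve for dimension over F and over the fixed field of an automorphism.
    Independent : (Fin r → Fin d → Carrier) → Set _
    Independent {r} {d} e = (β : Fin r → Carrier) → (∀ i → S (β i)) →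
      (∀ k → dot β (λ i → e i k) ≈ 0#) → ∀ i → β i ≈ 0#

    InSpan : (Fin r → Fin d → Carrier) → (Fin d → Carrier) → Set _
    InSpan {r} e v = ∃ λ (β : Fin r → Carrier) → (∀ i → S (β i)) × (∀ k → v k ≈ dot β (λ i → e i k))

    record Basis (P : (Fin d → Carrier) → Set p′) (r : ℕ) : Set (c ⊔ ℓ ⊔ p ⊔ p′) where
      field
        vec         : Fin r → Fin d → Carrier
        vec∈        : ∀ i → P (vec i)
        independent : Independent vec
        spans       : ∀ v → P v → InSpan vec v

    record IsSubspace (P : (Fin d → Carrier) → Set p′) : Set (c ⊔ ℓ ⊔ p ⊔ p′) where
      field
        respᵛ : ∀ {v w} → (∀ k → v k ≈ w k) → P v → P w
        0ᵛ∈   : P (λ _ → 0#)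
        +ᵛ∈   : ∀ {v w} → P v → P w → P (λ k → v k + w k)
        *ᵛ∈   : ∀ {t v} → S t → P v → P (λ k → t * v k)

      dot∈ : (β : Fin r → Carrier) → (∀ i → S (β i)) → (e : Fin r → Fin d → Carrier) →
             (∀ i → P (e i)) → P (λ k → dot β (λ i → e i k))
      dot∈ {zero}  β Sβ e Pe = 0ᵛ∈
      dot∈ {suc r} β Sβ e Pe =
        +ᵛ∈ (*ᵛ∈ (Sβ zero) (Pe zero)) (dot∈ (β ∘ suc) (Sβ ∘ suc) (e ∘ suc) (Pe ∘ suc))

  span-isSubspace : {S : Carrier → Set p} → IsSubfield S → (e : Fin r → Fin d → Carrier) →
                    IsSubspace S (InSpan S e)
  span-isSubspace isSubfield e = record
    { respᵛ = λ v≈w (β , Sβ , eq) → β , Sβ , λ k → trans (sym (v≈w k)) (eq k)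
    ; 0ᵛ∈ = (λ _ → 0#) , (λ _ → 0∈) , λ k → sym (dot-zeroˡ {f = λ _ → 0#} {g = λ i → e i k} (λ _ → refl))
    ; +ᵛ∈ = λ (β , Sβ , eq) (γ , Sγ , eq′) → (λ i → β i + γ i) , (λ i → +∈ (Sβ i) (Sγ i)) ,
        λ k → trans (+-cong (eq k) (eq′ k)) (sym (dot-+ˡ β γ _))
    ; *ᵛ∈ = λ {t} St (β , Sβ , eq) → (λ i → t * β i) , (λ i → *∈ St (Sβ i)) ,
        λ k → trans (*-congˡ (eq k)) (sym (dot-*ˡ t β _)) }
    where open IsSubfield isSubfield

  vec∈span : {S : Carrier → Set p} → IsSubfield S → (e : Fin r → Fin d → Carrier) → ∀ i → InSpan S e (e i)
  vec∈span isSubfield e i = unit i , unit∈ i , λ k → sym (dot-unit i _)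
    where open IsSubfield isSubfield

  -- Coordinates give a bijection with `r`-tuples from `S`: they exist by spanning and are unique by
  -- independence. Every comparison of dimensions passes through this count.
  basis-size : {S : Carrier → Set p} {P : (Fin d → Carrier) → Set p′} → IsSubfield S → IsSubspace S P →
               ∀ {s} → Restrict setoid S HasSize s → Basis S P r →
               Restrict (≋-setoid setoid d) P HasSize (s ℕ.^ r)
  basis-size {d = d} {r = r} {S = S} {P = P} isSubfield isSubspace I basis =
    coordinates ∘↔ vector-size I r
    where
    open IsSubfield isSubfield
    open IsSubspace isSubspace
    open Basis basis
    coords : ∀ v → P v → Fin r → Σ Carrier S
    coords v Pv i = let (β , Sβ , _) = spans v Pv in β i , Sβ i
    combine : (Fin r → Σ Carrier S) → Fin d → Carrier
    combine β k = dot (proj₁ ∘ β) (λ i → vec i k)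
    coords-sound : ∀ v Pv k → v k ≈ combine (coords v Pv) k
    coords-sound v Pv = proj₂ (proj₂ (spans v Pv))
    combine-injective : ∀ β γ → (∀ k → combine β k ≈ combine γ k) → ∀ i → proj₁ (β i) ≈ proj₁ (γ i)
    combine-injective β γ eq i = -≈0⇒≈ (trans (+-congˡ (sym (-1*x≈-x _)))
      (independent (λ i → proj₁ (β i) + - 1# * proj₁ (γ i))
        (λ i → +∈ (proj₂ (β i)) (*∈ (-∈ 1∈) (proj₂ (γ i))))
        (λ k → begin
          dot (λ i → proj₁ (β i) + - 1# * proj₁ (γ i)) (λ i → vec i k)
            ≈⟨ trans (dot-+ˡ (proj₁ ∘ β) (λ i → - 1# * proj₁ (γ i)) (λ i → vec i k))
                     (+-congˡ (dot-*ˡ (- 1#) (proj₁ ∘ γ) (λ i → vec i k))) ⟩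
          combine β k + - 1# * combine γ k
            ≈⟨ +-cong (eq k) (-1*x≈-x _) ⟩
          combine γ k - combine γ k ≈⟨ -‿inverseʳ _ ⟩
          0# ∎) i))
      where open import Algebra.Properties.Ring ring using (-1*x≈-x)
    coordinates : Inverse (Restrict (≋-setoid setoid d) P) (≋-setoid (Restrict setoid S) r)
    coordinates = mkInverse
      (λ { (v , Pv) → coords v Pv })
      (λ β → combine β , dot∈ (proj₁ ∘ β) (proj₂ ∘ β) vec vec∈)
      (λ { {v , Pv} {w , Pw} v≈w → combine-injective (coords v Pv) (coords w Pw)
             (λ k → trans (sym (coords-sound v Pv k)) (trans (v≈w k) (coords-sound w Pw k))) })
      (λ β≈γ k → dot-congʳ β≈γ)
      (λ β → let Pβ = dot∈ (proj₁ ∘ β) (proj₂ ∘ β) vec vec∈ in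
        combine-injective (coords (combine β) Pβ) β (λ k → sym (coords-sound (combine β) Pβ k)))
      (λ { (v , Pv) k → sym (coords-sound v Pv k) })

module FiniteField {c ℓ} (F : Field c ℓ) {N} (size : Field.setoid F HasSize N) where
  open Field F hiding (zero)
  open FieldProperties F
  open RingSolver commutativeRing
  open import Relation.Binary.Reasoning.Setoid setoid
  private variable d m n r : ℕ

  infix 4 _≟_
  _≟_ : Decidable _≈_
  _≟_ = _≈?_ size

  N≢0 : ℕ.NonZero N
  N≢0 = ℕ.>-nonZero (ℕₚ.≤-<-trans ℕ.z≤n (Finₚ.toℕ<n (Inverse.to size 0#)))

  vectors : ∀ d → ≋-setoid setoid d HasSize (N ℕ.^ d)
  vectors = vector-size size

  inSpan? : {S : Carrier → Set p} → IsSubfield S → (∀ x → Dec (S x)) →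
            (e : Fin r → Fin d → Carrier) → ∀ v → Dec (InSpan S e v)
  inSpan? {r = r} isSubfield S? e v = search (vectors r)
    (λ β≈γ (Sβ , eq) → (λ i → resp (β≈γ i) (Sβ i)) , λ k → trans (eq k) (dot-congʳ β≈γ))
    (λ β → Finₚ.all? (S? ∘ β) ×-dec Finₚ.all? (λ k → v k ≟ dot β (λ i → e i k)))
    where open IsSubfield isSubfield

  -- In a relation β₀ v + y = 0 with β₀ ≠ 0 one can solve for v, which would put it in the span.
  -- Decidable equality then yields β₀ = 0, and a relation among the `e i` remains.
  independent-∷ : {S : Carrier → Set p} → IsSubfield S → (e : Fin r → Fin d → Carrier) (v : Fin d → Carrier) →
                  Independent S e → ¬ InSpan S e v → Independent S (v ∷ e)
  independent-∷ {S = S} isSubfield e v indep v∉ β Sβ eq = λ { zero → β₀≈0 ; (suc i) → rest i }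
    where
    open IsSubfield isSubfield
    β₀ = β zero
    v∈ : ¬ (β₀ ≈ 0#) → InSpan S e v
    v∈ β₀≉0 = (λ i → - ((β₀ ⁻¹) β₀≉0) * β (suc i)) , (λ i → *∈ (-∈ (⁻¹∈ β₀≉0 (Sβ zero))) (Sβ (suc i))) ,
      λ k → let y = dot (β ∘ suc) (λ i → e i k) ; b = (β₀ ⁻¹) β₀≉0 in begin
        v k                         ≈⟨ solve 3 (λ b v y → v := v :- b :* :0) refl b (v k) y ⟩
        v k - b * 0#                ≈⟨ +-congˡ (-‿cong (*-congˡ (eq k))) ⟨
        v k - b * (β₀ * v k + y)
          ≈⟨ solve 4 (λ β b v y → v :- b :* (β :* v :+ y) := (:1 :- β :* b) :* v :+ :- b :* y)
               refl β₀ b (v k) y ⟩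
        (1# - β₀ * b) * v k + - b * y ≈⟨ +-congʳ (*-congʳ (≈⇒-≈0 (sym (⁻¹-inverse β₀ β₀≉0)))) ⟩
        0# * v k + - b * y          ≈⟨ trans (+-congʳ (zeroˡ _)) (+-identityˡ _) ⟩
        - b * y                     ≈⟨ dot-*ˡ (- b) (β ∘ suc) _ ⟨
        dot (λ i → - b * β (suc i)) (λ i → e i k) ∎
    β₀≈0 : β₀ ≈ 0#
    β₀≈0 = decidable-stable (β₀ ≟ 0#) (v∉ ∘ v∈)
    rest = indep (β ∘ suc) (Sβ ∘ suc) (λ k → begin
      dot (β ∘ suc) (λ i → e i k)             ≈⟨ +-identityˡ _ ⟨
      0# + dot (β ∘ suc) (λ i → e i k)        ≈⟨ +-congʳ (trans (*-congʳ β₀≈0) (zeroˡ _)) ⟨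
      β₀ * v k + dot (β ∘ suc) (λ i → e i k)  ≈⟨ eq k ⟩
      0#                                      ∎)

  -- All vectors of Fᵈ are listed; running through the list, a vector of `P` is kept exactly when it
  -- lies outside the span of those already kept. Both tests are decidable.
  basis-exists : {S : Carrier → Set p} {P : (Fin d → Carrier) → Set p′} →
                 IsSubfield S → (∀ x → Dec (S x)) →
                 (∀ {v w} → (∀ k → v k ≈ w k) → P v → P w) → (∀ v → Dec (P v)) → ∃ (Basis S P)
  basis-exists {d = d} {S = S} {P} isSubfield S? respᵛ P? =
    let (r , e , e∈ , indep , spans) = greedy _ from in
    r , record { vec = e ; vec∈ = e∈ ; independent = indep ; spans = λ v Pv →
      IsSubspace.respᵛ (span-isSubspace isSubfield e) (strictlyInverseʳ v)
        (spans (to v) (respᵛ (λ k → sym (strictlyInverseʳ v k)) Pv)) }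
    where
    open IsSubfield isSubfield
    open Inverse (vectors d)
    greedy : ∀ m (xs : Fin m → Fin d → Carrier) → ∃ λ r → ∃ λ (e : Fin r → Fin d → Carrier) →
             (∀ i → P (e i)) × Independent S e × (∀ j → P (xs j) → InSpan S e (xs j))
    greedy zero xs = 0 , (λ ()) , (λ ()) , (λ _ _ _ ()) , λ ()
    greedy (suc m) xs with greedy m (xs ∘ suc)
    ... | r , e , e∈ , indep , spans with P? (xs zero) | inSpan? isSubfield S? e (xs zero)
    ... | no ∉P | _ = r , e , e∈ , indep , λ { zero ∈P → ⊥-elim (∉P ∈P) ; (suc j) → spans j }
    ... | yes _ | yes ∈span = r , e , e∈ , indep , λ { zero _ → ∈span ; (suc j) → spans j }
    ... | yes ∈P | no ∉span = suc r , xs zero ∷ e , (λ { zero → ∈P ; (suc i) → e∈ i })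
      , independent-∷ isSubfield e (xs zero) indep ∉span
      , λ { zero _ → vec∈span isSubfield (xs zero ∷ e) zero
          ; (suc j) ∈P → let (β , Sβ , eq) = spans j ∈P in
              (0# ∷ β) , (λ { zero → 0∈ ; (suc i) → Sβ i }) ,
              λ k → trans (eq k) (sym (trans (+-congʳ (zeroˡ _)) (+-identityˡ _))) }

-- Kernels and images of matrices, one column at a time

module Matrices {c ℓ} (F : Field c ℓ) {N} (size : Field.setoid F HasSize N) where
  open Field F hiding (zero)
  open FieldProperties F
  open FiniteField F size
  open RingSolver commutativeRing
  open import Relation.Binary.Reasoning.Setoid setoid
  private variable d m n r : ℕ

  RightKernel : (Fin m → Fin n → Carrier) → (Fin n → Carrier) → Set ℓ
  RightKernel M v = ∀ i → dot (M i) v ≈ 0#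

  LeftKernel : (Fin m → Fin n → Carrier) → (Fin m → Carrier) → Set ℓ
  LeftKernel M u = ∀ j → dot u (λ i → M i j) ≈ 0#

  Image : (Fin m → Fin n → Carrier) → (Fin m → Carrier) → Set (c ⊔ ℓ)
  Image M y = ∃ λ v → ∀ i → dot (M i) v ≈ y i

  -- Either the first column C of M lies in the image of the remaining columns M′ (Dependent), or
  -- some vector in the left kernel of M′ is not orthogonal to C (Pivotal).
  module _ (M : Fin m → Fin (suc n) → Carrier) where
    private
      C : Fin m → Carrier
      C i = M i zero
      M′ : Fin m → Fin n → Carrier
      M′ i j = M i (suc j)

    LeftKernel-∷ : ∀ {u} → dot u C ≈ 0# → LeftKernel M′ u → LeftKernel M u
    LeftKernel-∷ uC≈0 uM′≈0 = λ { zero → uC≈0 ; (suc j) → uM′≈0 j }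

    module Dependent (s : Fin n → Carrier) (M′s≈C : ∀ i → dot (M′ i) s ≈ C i) where

      orthogonal : ∀ {u} → LeftKernel M′ u → dot u C ≈ 0#
      orthogonal {u} uM′≈0 = begin
        dot u C                             ≈⟨ dot-congˡ M′s≈C ⟨
        dot u (λ i → dot (M′ i) s)          ≈⟨ dot-dot u M′ s ⟩
        dot (λ j → dot u (λ i → M′ i j)) s  ≈⟨ dot-zeroˡ uM′≈0 ⟩
        0#                                  ∎

      left : Inverse (Restrict (≋-setoid setoid m) (LeftKernel M)) (Restrict (≋-setoid setoid m) (LeftKernel M′))
      left = mkInverse (λ { (u , k) → u , k ∘ suc }) (λ { (u , k) → u , LeftKernel-∷ (orthogonal k) k })
        (λ eq → eq) (λ eq → eq) (λ _ _ → refl) (λ _ _ → refl)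

      -- As C = M′ s, a multiple t of the first column can be absorbed into the remaining
      -- coordinates as t s.
      shift : ∀ i t w → dot (M i) (t ∷ w) ≈ dot (M′ i) (λ j → w j + t * s j)
      shift i t w = begin
        C i * t + dot (M′ i) w                      ≈⟨ +-congʳ (*-congʳ (M′s≈C i)) ⟨
        dot (M′ i) s * t + dot (M′ i) w
          ≈⟨ solve 3 (λ a t b → a :* t :+ b := b :+ t :* a)
               refl (dot (M′ i) s) t (dot (M′ i) w) ⟩
        dot (M′ i) w + t * dot (M′ i) s             ≈⟨ +-congˡ (dot-*ʳ t (M′ i) s) ⟨
        dot (M′ i) w + dot (M′ i) (λ j → t * s j)   ≈⟨ dot-+ʳ (M′ i) w (λ j → t * s j) ⟨
        dot (M′ i) (λ j → w j + t * s j)            ∎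

      -- A dependent column leaves its own coordinate free, so the right kernel grows by a factor
      -- `N` while the left kernel is unchanged.
      right : Inverse (Restrict (≋-setoid setoid (suc n)) (RightKernel M))
                      (×-setoid setoid (Restrict (≋-setoid setoid n) (RightKernel M′)))
      right = mkInverse
        (λ { (v , k) → v zero , (λ j → v (suc j) + v zero * s j) ,
               λ i → trans (sym (shift i (v zero) (v ∘ suc))) (k i) })
        (λ { (t , w , k) → (t ∷ λ j → w j - t * s j) ,
               λ i → trans (shift i t (λ j → w j - t * s j)) (trans (dot-congˡ (λ j → cancel (w j) (t * s j))) (k i)) })
        (λ eq → eq zero , λ j → +-cong (eq (suc j)) (*-congʳ (eq zero)))
        (λ { (eq , eqs) zero → eq ; (eq , eqs) (suc j) → +-cong (eqs j) (-‿cong (*-congʳ eq)) })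
        (λ { (t , w , _) → refl , λ j → cancel (w j) (t * s j) })
        (λ { (v , _) zero → refl
           ; (v , _) (suc j) → solve 2 (λ x y → (x :+ y) :- y := x) refl (v (suc j)) (v zero * s j) })
        where
        cancel : ∀ x y → (x - y) + y ≈ x
        cancel = solve 2 (λ x y → (x :- y) :+ y := x) refl

      image : ∀ {y} → Image M′ y → Image M y
      image (v , eq) = (0# ∷ v) , λ i → trans (+-congʳ (zeroʳ (C i))) (trans (+-identityˡ _) (eq i))

    module Pivotal (u₀ : Fin m → Carrier) (u₀M′≈0 : LeftKernel M′ u₀) (u₀C≉0 : ¬ (dot u₀ C ≈ 0#)) where
      π⁻¹ : Carrier
      π⁻¹ = (dot u₀ C ⁻¹) u₀C≉0

      π⁻¹*π : ∀ x → (π⁻¹ * x) * dot u₀ C ≈ x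
      π⁻¹*π x = begin
        (π⁻¹ * x) * dot u₀ C
          ≈⟨ solve 3 (λ a x b → (a :* x) :* b := (b :* a) :* x)
               refl π⁻¹ x (dot u₀ C) ⟩
        (dot u₀ C * π⁻¹) * x  ≈⟨ *-congʳ (⁻¹-inverse (dot u₀ C) u₀C≉0) ⟩
        1# * x                ≈⟨ *-identityˡ x ⟩
        x                     ∎

      -- Pairing M v = 0 with u₀ kills every column except the first, which leaves π v₀ = 0 for the
      -- non-zero pivot π = u₀ · C.
      first-zero : ∀ {v} → RightKernel M v → v zero ≈ 0#
      first-zero {v} Mv≈0 = *-cancel-≉0 u₀C≉0 (begin
        dot u₀ C * v zero
          ≈⟨ +-identityʳ _ ⟨
        dot u₀ C * v zero + 0#
          ≈⟨ +-congˡ (dot-zeroˡ {g = v ∘ suc} u₀M′≈0) ⟨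
        dot u₀ C * v zero + dot (λ j → dot u₀ (λ i → M′ i j)) (v ∘ suc)
          ≈⟨ dot-dot u₀ M v ⟨
        dot u₀ (λ i → dot (M i) v)
          ≈⟨ trans (dot-congˡ Mv≈0) (sum-zero (λ i → zeroʳ (u₀ i))) ⟩
        0# ∎)

      drop-zero : ∀ i v → v zero ≈ 0# → dot (M i) v ≈ dot (M′ i) (v ∘ suc)
      drop-zero i v v₀≈0 = trans (+-congʳ (trans (*-congˡ v₀≈0) (zeroʳ _))) (+-identityˡ _)

      right : Inverse (Restrict (≋-setoid setoid (suc n)) (RightKernel M))
                      (Restrict (≋-setoid setoid n) (RightKernel M′))
      right = mkInverse
        (λ { (v , k) → v ∘ suc , λ i → trans (sym (drop-zero i v (first-zero {v} k))) (k i) })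
        (λ { (w , k) → (0# ∷ w) , λ i → trans (drop-zero i (0# ∷ w) refl) (k i) })
        (λ eq → eq ∘ suc)
        (λ { eq zero → refl ; eq (suc j) → eq j })
        (λ _ _ → refl)
        (λ { (v , k) zero → sym (first-zero {v} k) ; (v , k) (suc j) → refl })

      subtract : (Fin m → Carrier) → Carrier → Fin m → Carrier
      subtract u t i = u i - t * u₀ i

      dot-subtract : ∀ u t f → dot (subtract u t) f ≈ dot u f - t * dot u₀ f
      dot-subtract u t f = begin
        dot (subtract u t) f
          ≈⟨ sum-cong-≋ (λ i → solve 4 (λ a t b f → (a :- t :* b) :* f := a :* f :+ (:- t) :* b :* f)
               refl (u i) t (u₀ i) (f i)) ⟩
        sum (λ i → u i * f i + - t * u₀ i * f i)
          ≈⟨ ∑-distrib-+ (λ i → u i * f i) (λ i → - t * u₀ i * f i) ⟩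
        dot u f + dot (λ i → - t * u₀ i) f
          ≈⟨ +-congˡ (dot-*ˡ (- t) u₀ f) ⟩
        dot u f + - t * dot u₀ f
          ≈⟨ solve 3 (λ a t b → a :+ (:- t) :* b := a :- t :* b) refl (dot u f) t (dot u₀ f) ⟩
        dot u f - t * dot u₀ f ∎

      subtract-M′ : ∀ {u} t → LeftKernel M′ u → LeftKernel M′ (subtract u t)
      subtract-M′ {u} t k j = trans (dot-subtract u t (λ i → M′ i j))
        (≈⇒-≈0 (trans (k j) (sym (trans (*-congˡ (u₀M′≈0 j)) (zeroʳ t)))))

      eliminate : ∀ {u} → LeftKernel M′ u → LeftKernel M (subtract u (π⁻¹ * dot u C))
      eliminate {u} k = LeftKernel-∷
        (trans (dot-subtract u (π⁻¹ * dot u C) C) (≈⇒-≈0 (sym (π⁻¹*π (dot u C)))))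
        (subtract-M′ (π⁻¹ * dot u C) k)

      -- The value u · C is an additional free coordinate on the left kernel of M′. Subtracting the
      -- multiple of u₀ with the same value lands in the left kernel of M.
      left : Inverse (Restrict (≋-setoid setoid m) (LeftKernel M′))
                     (×-setoid setoid (Restrict (≋-setoid setoid m) (LeftKernel M)))
      left = mkInverse
        (λ { (u , k) → dot u C , subtract u (π⁻¹ * dot u C) , eliminate k })
        (λ { (t , w , k) → subtract w (- (π⁻¹ * t)) , subtract-M′ (- (π⁻¹ * t)) (k ∘ suc) })
        (λ eq → dot-congʳ eq , λ i → +-cong (eq i) (-‿cong (*-congʳ (*-congˡ (dot-congʳ eq)))))
        (λ { (eq , eqs) i → +-cong (eqs i) (-‿cong (*-congʳ (-‿cong (*-congˡ eq)))) })
        (λ { (t , w , k) → recover t w k , λ i →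
             trans (+-congˡ (-‿cong (*-congʳ (*-congˡ (recover t w k)))))
               (solve 3 (λ x a b → (x :- (:- a) :* b) :- a :* b := x) refl (w i) (π⁻¹ * t) (u₀ i)) })
        (λ { (u , k) i → solve 3 (λ x a b → (x :- a :* b) :- (:- a) :* b := x) refl
             (u i) (π⁻¹ * dot u C) (u₀ i) })
        where
        recover : ∀ t w → LeftKernel M w → dot (subtract w (- (π⁻¹ * t))) C ≈ t
        recover t w k = begin
          dot (subtract w (- (π⁻¹ * t))) C     ≈⟨ dot-subtract w (- (π⁻¹ * t)) C ⟩
          dot w C - - (π⁻¹ * t) * dot u₀ C     ≈⟨ +-congʳ (k zero) ⟩
          0# - - (π⁻¹ * t) * dot u₀ C
            ≈⟨ solve 2 (λ a b → :0 :- (:- a) :* b := a :* b)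
                 refl (π⁻¹ * t) (dot u₀ C) ⟩
          (π⁻¹ * t) * dot u₀ C                 ≈⟨ π⁻¹*π t ⟩
          t                                    ∎

      image : (∀ {y} → (∀ {u} → LeftKernel M′ u → dot u y ≈ 0#) → Image M′ y) →
              ∀ {y} → (∀ {u} → LeftKernel M u → dot u y ≈ 0#) → Image M y
      image fredholm′ {y} ⊥y = (t ∷ w) , λ i → trans (+-congˡ (eq i))
          (solve 3 (λ c t y → c :* t :+ (y :- t :* c) := y) refl (C i) t (y i))
        where
        -- This choice is forced: y - t C must lie in the image of M′, hence be orthogonal to u₀.
        t = π⁻¹ * dot u₀ y
        solution : Image M′ (λ i → y i - t * C i)
        solution = fredholm′ (λ {u} k → begin
          dot u (λ i → y i - t * C i)
            ≈⟨ dot-congˡ (λ i → solve 3 (λ y t c → y :- t :* c := y :+ (:- t) :* c)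
                 refl (y i) t (C i)) ⟩
          dot u (λ i → y i + - t * C i)
            ≈⟨ trans (dot-+ʳ u y (λ i → - t * C i)) (+-congˡ (dot-*ʳ (- t) u C)) ⟩
          dot u y + - t * dot u C
            ≈⟨ solve 4 (λ a p b c → a :+ (:- (p :* b)) :* c := a :- (p :* c) :* b)
                 refl (dot u y) π⁻¹ (dot u₀ y) (dot u C) ⟩
          dot u y - (π⁻¹ * dot u C) * dot u₀ y
            ≈⟨ dot-subtract u (π⁻¹ * dot u C) y ⟨
          dot (subtract u (π⁻¹ * dot u C)) y
            ≈⟨ ⊥y (eliminate k) ⟩
          0# ∎)
        w = proj₁ solution
        eq = proj₂ solution

  pivot? : (M : Fin m → Fin n → Carrier) (y : Fin m → Carrier) →
           Dec (∃ λ u → LeftKernel M u × ¬ (dot u y ≈ 0#))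
  pivot? {m} M y = search (vectors m)
    (λ u≈w (k , ≉0) → (λ j → trans (sym (dot-congʳ u≈w)) (k j)) , λ eq → ≉0 (trans (dot-congʳ u≈w) eq))
    (λ u → Finₚ.all? (λ j → dot u (λ i → M i j) ≟ 0#) ×-dec ¬? (dot u y ≟ 0#))

  no-pivot : {M : Fin m → Fin n → Carrier} {y : Fin m → Carrier} →
             ¬ (∃ λ u → LeftKernel M u × ¬ (dot u y ≈ 0#)) → ∀ {u} → LeftKernel M u → dot u y ≈ 0#
  no-pivot none {u} k = decidable-stable (_ ≟ _) (λ ≉0 → none (u , k , ≉0))

  abstract
    -- Induction on the columns. Without columns the left kernel is everything, so y is orthogonal
    -- to all unit vectors and vanishes. A dependent column does not change the left kernel; a
    -- pivotal one is used to remove a suitable multiple of C from y.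
    fredholm : ∀ n (M : Fin m → Fin n → Carrier) {y} →
               (∀ {u} → LeftKernel M u → dot u y ≈ 0#) → Image M y
    fredholm zero M {y} ⊥y = (λ ()) , λ i → sym (trans (sym (dot-unit i y)) (⊥y (λ ())))
    fredholm (suc n) M ⊥y with pivot? (λ i j → M i (suc j)) (λ i → M i zero)
    ... | yes (u , k , ≉0) = Pivotal.image M u k ≉0 (fredholm n _) ⊥y
    ... | no none = let (s , eq) = fredholm n _ (no-pivot none) in
      Dependent.image M s eq (fredholm n _ (λ {u} k → ⊥y (LeftKernel-∷ M (Dependent.orthogonal M s eq k) k)))

  left-size : (M : Fin m → Fin n → Carrier) → ∃ λ k → Restrict (≋-setoid setoid m) (LeftKernel M) HasSize k
  left-size {m} M = subset-size (vectors m) (λ u≈w k j → trans (sym (dot-congʳ u≈w)) (k j))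
    (λ u → Finₚ.all? (λ j → dot u (λ i → M i j) ≟ 0#))

  right-size : (M : Fin m → Fin n → Carrier) → ∃ λ k → Restrict (≋-setoid setoid n) (RightKernel M) HasSize k
  right-size {n = n} M = subset-size (vectors n) (λ u≈w k j → trans (sym (dot-congˡ u≈w)) (k j))
    (λ v → Finₚ.all? (λ i → dot (M i) v ≟ 0#))

  -- Equality of row and column rank in multiplicative form: for rank ρ both sides are N ^ (m + n -
  -- ρ). Each further column either multiplies the right kernel by `N` or divides the left kernel by
  -- `N`, and the factor on the right of the equation compensates. For a square matrix the two
  -- kernels have the same size.
  kernel-sizes : ∀ n (M : Fin m → Fin n → Carrier) {r l} →
    Restrict (≋-setoid setoid n) (RightKernel M) HasSize r →
    Restrict (≋-setoid setoid m) (LeftKernel M) HasSize l → r ℕ.* N ℕ.^ m ≡ l ℕ.* N ℕ.^ n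
  kernel-sizes {m} zero M {r} {l} I J = ≡.trans
    (≡.cong₂ ℕ._*_ (size-unique I one) (size-unique (vectors m) all))
    (ℕₚ.*-comm 1 l)
    where
    one : Restrict (≋-setoid setoid 0) (RightKernel M) HasSize 1
    one = mkInverse (λ _ → zero) (λ _ → (λ ()) , λ _ → refl) (λ _ → ≡.refl) (λ _ ())
      (λ { zero → ≡.refl ; (suc ()) }) (λ _ ())
    all : ≋-setoid setoid m HasSize l
    all = mkInverse {T = Restrict (≋-setoid setoid m) (LeftKernel M)} (λ u → u , λ ()) proj₁
      (λ eq → eq) (λ eq → eq) (λ _ _ → refl) (λ _ _ → refl) ∘↔ J
  kernel-sizes {m} (suc n) M {r} {l} I J with pivot? (λ i j → M i (suc j)) (λ i → M i zero)
  ... | yes (u , k , ≉0) = ≡.trans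
      (kernel-sizes n _ (Symm.inverse right ∘↔ I) (left ∘↔ ×-size size J))
      (≡.trans (≡.cong (ℕ._* N ℕ.^ n) (ℕₚ.*-comm N l)) (ℕₚ.*-assoc l N (N ℕ.^ n)))
    where open Pivotal M u k ≉0
  ... | no none = begin-≡
    where
    M′ = λ i j → M i (suc j)
    s = fredholm n M′ (no-pivot none)
    open Dependent M (proj₁ s) (proj₂ s)
    r′ = right-size M′
    begin-≡ : r ℕ.* N ℕ.^ m ≡ l ℕ.* N ℕ.^ suc n
    begin-≡ = R.begin
      r ℕ.* N ℕ.^ m                   R.≡⟨ ≡.cong (ℕ._* N ℕ.^ m) (size-unique I (right ∘↔ ×-size size (proj₂ r′))) ⟩
      N ℕ.* proj₁ r′ ℕ.* N ℕ.^ m      R.≡⟨ ℕₚ.*-assoc N (proj₁ r′) (N ℕ.^ m) ⟩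
      N ℕ.* (proj₁ r′ ℕ.* N ℕ.^ m)    R.≡⟨ ≡.cong (N ℕ.*_) (kernel-sizes n M′ (proj₂ r′) (Symm.inverse left ∘↔ J)) ⟩
      N ℕ.* (l ℕ.* N ℕ.^ n)           R.≡⟨ ℕₚ.*-assoc N l (N ℕ.^ n) ⟨
      N ℕ.* l ℕ.* N ℕ.^ n             R.≡⟨ ≡.cong (ℕ._* N ℕ.^ n) (ℕₚ.*-comm N l) ⟩
      l ℕ.* N ℕ.* N ℕ.^ n             R.≡⟨ ℕₚ.*-assoc l N (N ℕ.^ n) ⟩
      l ℕ.* (N ℕ.* N ℕ.^ n)           R.∎
      where module R = ≡.≡-Reasoning

  trivial-size : {P : (Fin m → Carrier) → Set p} → P (λ _ → 0#) → (∀ v → P v → ∀ i → v i ≈ 0#) →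
                 Restrict (≋-setoid setoid m) P HasSize 1
  trivial-size 0∈P P≈0 = mkInverse (λ _ → zero) (λ _ → (λ _ → 0#) , 0∈P) (λ _ → ≡.refl) (λ _ _ → refl)
    (λ { zero → ≡.refl ; (suc ()) }) (λ { (v , Pv) i → sym (P≈0 v Pv i) })

  -- By counting, the left kernel is as large as the right one, hence a single point, and it
  -- contains 0.
  square-trivial-kernels : (M : Fin m → Fin m → Carrier) → (∀ v → RightKernel M v → ∀ i → v i ≈ 0#) →
                           ∀ u → LeftKernel M u → ∀ i → u i ≈ 0#
  square-trivial-kernels {m} M right-trivial u k i = trans (sym (strictlyInverseʳ (u , k) i))
    (trans (from-cong (one≡ (to (u , k)) (to zeroᵏ)) i) (strictlyInverseʳ zeroᵏ i))
    where
    one : Restrict (≋-setoid setoid m) (LeftKernel M) HasSize 1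
    one = let (l , I) = left-size M
              1≡l = ℕₚ.*-cancelʳ-≡ 1 l (N ℕ.^ m) ⦃ ℕₚ.m^n≢0 N m ⦃ N≢0 ⦄ ⦄ (kernel-sizes m M
                (trivial-size (λ i → sum-zero (λ j → zeroʳ (M i j))) right-trivial) I)
          in ≡.subst (Restrict (≋-setoid setoid m) (LeftKernel M) HasSize_) (≡.sym 1≡l) I
    open Inverse one
    one≡ : (x y : Fin 1) → x ≡ y
    one≡ zero zero = ≡.refl
    zeroᵏ : Σ (Fin m → Carrier) (LeftKernel M)
    zeroᵏ = (λ _ → 0#) , λ j → dot-zeroˡ {g = λ i → M i j} (λ _ → refl)

-- Skew polynomials and Galois descent

module Twisted {c ℓ} (F : Field c ℓ) {N} (size : Field.setoid F HasSize N)
               (τ : Field.Carrier F → Field.Carrier F) (isAut : FieldDefs.IsRingAut F τ) where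
  open Field F hiding (zero)
  open FieldDefs F using (iter; IsRingAut)
  open IsRingAut isAut renaming (cong to τ-cong; hom-+ to τ-+; hom-* to τ-*; hom-1 to τ-1)
  open FieldProperties F
  open FiniteField F size
  open Matrices F size
  open RingSolver commutativeRing
  open import Algebra.Properties.Ring ring using (x+x≈x⇒x≈0; -0#≈0#)
  open import Algebra.Properties.Group +-group using (inverseʳ-unique)
  open import Relation.Binary.Reasoning.Setoid setoid
  private variable d m n r : ℕ

  Fixed : Carrier → Set ℓ
  Fixed x = τ x ≈ x

  fixed? : ∀ x → Dec (Fixed x)
  fixed? x = τ x ≟ x

  τ-0 : τ 0# ≈ 0#
  τ-0 = x+x≈x⇒x≈0 _ (trans (sym (τ-+ 0# 0#)) (τ-cong (+-identityˡ 0#)))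

  τ-neg : ∀ x → τ (- x) ≈ - τ x
  τ-neg x = inverseʳ-unique (τ x) (τ (- x))
    (trans (sym (τ-+ x (- x))) (trans (τ-cong (-‿inverseʳ x)) τ-0))

  τ-dot : (f g : Fin n → Carrier) → τ (dot f g) ≈ dot (τ ∘ f) (τ ∘ g)
  τ-dot {zero} f g = τ-0
  τ-dot {suc n} f g = trans (τ-+ _ _) (+-cong (τ-* _ _) (τ-dot (f ∘ suc) (g ∘ suc)))

  fixed-isSubfield : IsSubfield Fixed
  fixed-isSubfield = record
    { resp = λ x≈y Sx → trans (τ-cong (sym x≈y)) (trans Sx x≈y)
    ; 0∈ = τ-0
    ; 1∈ = τ-1
    ; +∈ = λ Sx Sy → trans (τ-+ _ _) (+-cong Sx Sy)
    ; *∈ = λ Sx Sy → trans (τ-* _ _) (*-cong Sx Sy)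
    ; -∈ = λ Sx → trans (τ-neg _) (-‿cong Sx)
    ; ⁻¹∈ = λ {x} x≉0 Sx → let y = (x ⁻¹) x≉0 in -≈0⇒≈ (*-cancel-≉0 x≉0 (begin
        x * (τ y - y)      ≈⟨ solve 3 (λ x t y → x :* (t :- y) := x :* t :- x :* y) refl x (τ y) y ⟩
        x * τ y - x * y    ≈⟨ +-congʳ (trans (*-congʳ (sym Sx)) (sym (τ-* x y))) ⟩
        τ (x * y) - x * y
          ≈⟨ ≈⇒-≈0 (trans (τ-cong (⁻¹-inverse x x≉0)) (trans τ-1 (sym (⁻¹-inverse x x≉0)))) ⟩
        0#                 ∎))
    }
  open IsSubfield fixed-isSubfield

  iter-cong : ∀ i {x y} → x ≈ y → iter τ i x ≈ iter τ i y
  iter-cong zero eq = eq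
  iter-cong (suc i) eq = τ-cong (iter-cong i eq)

  iter-* : ∀ i x y → iter τ i (x * y) ≈ iter τ i x * iter τ i y
  iter-* zero x y = refl
  iter-* (suc i) x y = trans (τ-cong (iter-* i x y)) (τ-* _ _)

  iter-1 : ∀ i → iter τ i 1# ≈ 1#
  iter-1 zero = refl
  iter-1 (suc i) = trans (τ-cong (iter-1 i)) τ-1

  iter-injective : ∀ i {x y} → iter τ i x ≈ iter τ i y → x ≈ y
  iter-injective zero eq = eq
  iter-injective (suc i) eq = iter-injective i (injective eq)

  iter-dot : ∀ i (f g : Fin n → Carrier) → (∀ j → Fixed (f j)) →
             iter τ i (dot f g) ≈ dot f (iter τ i ∘ g)
  iter-dot zero f g Sf = refl
  iter-dot (suc i) f g Sf =
    trans (τ-cong (iter-dot i f g Sf)) (trans (τ-dot f (iter τ i ∘ g)) (dot-congʳ Sf))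

  iter-dot-* : ∀ i (f g : Fin n → Carrier) → iter τ i (dot f g) ≈ dot (iter τ i ∘ f) (iter τ i ∘ g)
  iter-dot-* zero f g = refl
  iter-dot-* (suc i) f g = trans (τ-cong (iter-dot-* i f g)) (τ-dot (iter τ i ∘ f) (iter τ i ∘ g))

  iter-suc : ∀ i x → iter τ (suc i) x ≡ iter τ i (τ x)
  iter-suc zero x = ≡.refl
  iter-suc (suc i) x = ≡.cong τ (iter-suc i x)

  iter-+ : ∀ i j x → iter τ (i ℕ.+ j) x ≡ iter τ i (iter τ j x)
  iter-+ zero j x = ≡.refl
  iter-+ (suc i) j x = ≡.cong τ (iter-+ i j x)

  orbit : Carrier → Fin n → Carrier
  orbit x i = iter τ (toℕ i) x

  -- The operator Σ cᵢ τⁱ applied to `x`. Splitting off the lowest term and passing to τ x matches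
  -- the recursion of the division below.
  skew : (Fin n → Carrier) → Carrier → Carrier
  skew {zero}  c x = 0#
  skew {suc n} c x = c zero * x + skew (c ∘ suc) (τ x)

  skew≈dot : (c : Fin n → Carrier) (x : Carrier) → skew c x ≈ dot c (orbit x)
  skew≈dot {zero} c x = refl
  skew≈dot {suc n} c x = +-congˡ (trans (skew≈dot (c ∘ suc) (τ x))
    (dot-congˡ {f = c ∘ suc} (λ i → reflexive (≡.sym (iter-suc (toℕ i) x)))))

  skew-cong : (c : Fin n → Carrier) {x y : Carrier} → x ≈ y → skew c x ≈ skew c y
  skew-cong {zero} c eq = refl
  skew-cong {suc n} c eq = +-cong (*-congˡ eq) (skew-cong (c ∘ suc) (τ-cong eq))

  -- Quotient and remainder in the right division by τ − u.
  divide : (Fin (suc n) → Carrier) → Carrier → (Fin n → Carrier) × Carrier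
  divide {zero}  c u = (λ ()) , c zero
  divide {suc n} c u = let (Q , ρ) = divide (c ∘ suc) (τ u) in (ρ ∷ Q) , c zero + ρ * u

  -- The tail of the coefficients is divided by τ - τ u rather than τ - u because (τ - τ u) τ = τ (τ
  -- - u) as operators. The remainder ρ of the tail then gives ρ τ = ρ (τ - u) + ρ u.
  divide-correct : (c : Fin (suc n) → Carrier) (u x : Carrier) → let (Q , ρ) = divide c u in
                   skew c x ≈ skew Q (τ x - u * x) + ρ * x
  divide-correct {zero} c u x = +-comm _ _
  divide-correct {suc n} c u x = let (Q , ρ) = divide (c ∘ suc) (τ u) in begin
    c zero * x + skew (c ∘ suc) (τ x)
      ≈⟨ +-congˡ (divide-correct (c ∘ suc) (τ u) (τ x)) ⟩
    c zero * x + (skew Q (τ (τ x) - τ u * τ x) + ρ * τ x)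
      ≈⟨ +-congˡ (+-congʳ (skew-cong Q (trans
           (+-congˡ (trans (-‿cong (sym (τ-* u x))) (sym (τ-neg (u * x)))))
           (sym (τ-+ (τ x) (- (u * x))))))) ⟩
    c zero * x + (skew Q (τ (τ x - u * x)) + ρ * τ x)
      ≈⟨ solve 6 (λ c x s ρ t u → c :* x :+ (s :+ ρ :* t) := (ρ :* (t :- u :* x) :+ s) :+ (c :+ ρ :* u) :* x)
           refl (c zero) x (skew Q (τ (τ x - u * x))) ρ (τ x) u ⟩
    (ρ * (τ x - u * x) + skew Q (τ (τ x - u * x))) + (c zero + ρ * u) * x ∎

  divide-zero : (c : Fin (suc n) → Carrier) (u : Carrier) → let (Q , ρ) = divide c u in
                (∀ i → Q i ≈ 0#) → ρ ≈ 0# → ∀ i → c i ≈ 0#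
  divide-zero {zero} c u Q≈0 ρ≈0 zero = ρ≈0
  divide-zero {suc n} c u Q≈0 ρ≈0 = λ
    { zero → trans (sym (+-identityʳ _)) (trans (+-congˡ (sym (trans (*-congʳ (Q≈0 zero)) (zeroˡ u)))) ρ≈0)
    ; (suc i) → divide-zero (c ∘ suc) (τ u) (Q≈0 ∘ suc) (Q≈0 zero) i }

  IndependentScalars : (Fin r → Carrier) → Set _
  IndependentScalars e = Independent Fixed {d = 1} (λ j _ → e j)

  -- A nonzero skew polynomial with n coefficients has no n independent roots: if e₀ is a root,
  -- then it is divisible by τ − u with u = τ e₀ / e₀, whose kernel is spanned by e₀.
  skew-vanish : n ℕ.≤ m → (c : Fin n → Carrier) (e : Fin m → Carrier) → IndependentScalars e →
                (∀ j → skew c (e j) ≈ 0#) → ∀ i → c i ≈ 0#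
  skew-vanish z≤n c e indep root = λ ()
  skew-vanish {m = suc m} (s≤s n≤m) c e indep root = divide-zero c u (skew-vanish n≤m Q e′ indep′ root′) ρ≈0
    where
    e₀ = e zero
    e₀≉0 : ¬ (e₀ ≈ 0#)
    e₀≉0 e₀≈0 = 0≉1 (sym (indep (unit zero) (unit∈ zero) (λ _ → trans (dot-unit zero e) e₀≈0) zero))
    e₀⁻¹ = (e₀ ⁻¹) e₀≉0
    u = τ e₀ * e₀⁻¹
    ue₀ : ∀ x → u * (e₀ * x) ≈ τ e₀ * x
    ue₀ x = begin
      τ e₀ * e₀⁻¹ * (e₀ * x)
        ≈⟨ solve 4 (λ t i e x → t :* i :* (e :* x) := (e :* i) :* (t :* x))
             refl (τ e₀) e₀⁻¹ e₀ x ⟩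
      (e₀ * e₀⁻¹) * (τ e₀ * x)    ≈⟨ trans (*-congʳ (⁻¹-inverse e₀ e₀≉0)) (*-identityˡ _) ⟩
      τ e₀ * x                    ∎
    Q = proj₁ (divide c u)
    ρ = proj₂ (divide c u)
    skew-0 : ∀ {n} (c : Fin n → Carrier) → skew c 0# ≈ 0#
    skew-0 {zero} c = refl
    skew-0 {suc n} c = trans (+-cong (zeroʳ _) (trans (skew-cong (c ∘ suc) τ-0) (skew-0 (c ∘ suc)))) (+-identityˡ _)
    τe₀-ue₀≈0 : τ e₀ - u * e₀ ≈ 0#
    τe₀-ue₀≈0 = ≈⇒-≈0 (sym (trans (*-congˡ (sym (*-identityʳ e₀))) (trans (ue₀ 1#) (*-identityʳ _))))
    ρ≈0 : ρ ≈ 0#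
    ρ≈0 = *-cancel-≉0 e₀≉0 (begin
      e₀ * ρ                         ≈⟨ *-comm _ _ ⟩
      ρ * e₀                         ≈⟨ +-identityˡ _ ⟨
      0# + ρ * e₀                    ≈⟨ +-congʳ (trans (skew-cong Q τe₀-ue₀≈0) (skew-0 Q)) ⟨
      skew Q (τ e₀ - u * e₀) + ρ * e₀  ≈⟨ divide-correct c u e₀ ⟨
      skew c e₀                      ≈⟨ root zero ⟩
      0#                             ∎)
    e′ : Fin m → Carrier
    e′ j = τ (e (suc j)) - u * e (suc j)
    root′ : ∀ j → skew Q (e′ j) ≈ 0#
    root′ j = begin
      skew Q (e′ j)                   ≈⟨ +-identityʳ _ ⟨
      skew Q (e′ j) + 0#              ≈⟨ +-congˡ (trans (*-congʳ ρ≈0) (zeroˡ _)) ⟨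
      skew Q (e′ j) + ρ * e (suc j)   ≈⟨ divide-correct c u (e (suc j)) ⟨
      skew c (e (suc j))              ≈⟨ root (suc j) ⟩
      0#                              ∎
    -- A relation among the `e′ j` puts x = Σ βⱼ eⱼ, summed over the remaining elements, into the
    -- kernel of τ - u. So x = κ e₀ with κ fixed by τ, and this is a relation among the original
    -- elements.
    indep′ : IndependentScalars e′
    indep′ β Sβ eq j = indep (- κ ∷ β) (λ { zero → -∈ κ∈ ; (suc j) → Sβ j })
        (λ _ → trans (solve 3 (λ κ e x → :- κ :* e :+ x := x :- e :* κ) refl κ e₀ x) (≈⇒-≈0 (sym e₀κ)))
        (suc j)
      where
      x = dot β (e ∘ suc)
      κ = e₀⁻¹ * x
      e₀κ : e₀ * κ ≈ x
      e₀κ = trans (sym (*-assoc _ _ _)) (trans (*-congʳ (⁻¹-inverse e₀ e₀≉0)) (*-identityˡ x))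
      τx≈ux : τ x ≈ u * x
      τx≈ux = -≈0⇒≈ (begin
        τ x - u * x
          ≈⟨ +-cong (iter-dot 1 β (e ∘ suc) Sβ) (-‿cong (sym (dot-*ʳ u β (e ∘ suc)))) ⟩
        dot β (τ ∘ e ∘ suc) - dot β (λ j → u * e (suc j))
          ≈⟨ dot-minusʳ β (τ ∘ e ∘ suc) (λ j → u * e (suc j)) ⟨
        dot β e′
          ≈⟨ eq zero ⟩
        0# ∎)
      κ∈ : Fixed κ
      κ∈ = -≈0⇒≈ (*-cancel-≉0 (λ τe₀≈0 → e₀≉0 (injective (trans τe₀≈0 (sym τ-0)))) (begin
        τ e₀ * (τ κ - κ)
          ≈⟨ solve 3 (λ e t k → e :* (t :- k) := e :* t :- e :* k)
               refl (τ e₀) (τ κ) κ ⟩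
        τ e₀ * τ κ - τ e₀ * κ
          ≈⟨ +-cong (trans (sym (τ-* e₀ κ)) (τ-cong e₀κ)) (-‿cong (trans (sym (ue₀ κ)) (*-congˡ e₀κ))) ⟩
        τ x - u * x            ≈⟨ ≈⇒-≈0 τx≈ux ⟩
        0#                     ∎))

  orbit-vanish : n ℕ.≤ m → (c : Fin n → Carrier) (e : Fin m → Carrier) → IndependentScalars e →
                 (∀ j → dot c (orbit (e j)) ≈ 0#) → ∀ i → c i ≈ 0#
  orbit-vanish n≤m c e indep root = skew-vanish n≤m c e indep (λ j → trans (skew≈dot c (e j)) (root j))

  fixed-size : ∃ λ s → Restrict setoid Fixed HasSize s
  fixed-size = subset-size size resp fixed?

  Everything : ∀ {d} → (Fin d → Carrier) → Set
  Everything _ = ⊤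

  field-basis : ∃ (Basis Fixed (Everything {1}))
  field-basis = basis-exists fixed-isSubfield fixed? (λ _ _ → tt) (λ _ → yes tt)

  fixed-size^degree : ∀ {s} → Restrict setoid Fixed HasSize s → Basis Fixed (Everything {1}) m → s ℕ.^ m ≡ N
  fixed-size^degree I basis = size-unique
    (basis-size fixed-isSubfield (record { respᵛ = λ _ _ → tt ; 0ᵛ∈ = tt ; +ᵛ∈ = λ _ _ → tt ; *ᵛ∈ = λ _ _ → tt })
      I basis)
    (mkInverse {T = setoid} (λ { (v , _) → v zero }) (λ x → (λ _ → x) , tt) (λ eq → eq zero) (λ eq _ → eq)
      (λ _ → refl) (λ { _ zero → refl }) ∘↔ size)

  module _ (basis : Basis Fixed (Everything {1}) m) where
    open Basis basis

    generator : Fin m → Carrier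
    generator j = vec j zero

    generators-independent : IndependentScalars generator
    generators-independent β Sβ eq = independent β Sβ (λ { zero → eq zero })

    generators-span : ∀ x → ∃ λ β → (∀ j → Fixed (β j)) × x ≈ dot β generator
    generators-span x = let (β , Sβ , eq) = spans (λ _ → x) tt in β , Sβ , eq zero

    -- Otherwise the n + 1 coefficients of τⁿ - 1, which vanishes on all of F, would be zero by the
    -- bound. The constant coefficient is -1, since n ≥ 1 keeps the two terms apart.
    degree≤order : ∀ {n} → 1 ℕ.≤ n → (∀ x → iter τ n x ≈ x) → m ℕ.≤ n
    degree≤order {suc n} _ τⁿ≈1 with m ℕₚ.≤? suc n
    ... | yes m≤n = m≤n
    ... | no m≰n = ⊥-elim (0≉1 (begin
        0#             ≈⟨ -0#≈0# ⟨
        - 0#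
          ≈⟨ -‿cong (orbit-vanish (ℕₚ.≰⇒> m≰n) b generator generators-independent (root ∘ generator) zero) ⟨
        - b zero    ≈⟨ solve 1 (λ x → :- (:0 :- x) := x) refl 1# ⟩
        1#             ∎))
      where
      bottom top : Fin (suc (suc n))
      bottom = zero
      top = Fin.fromℕ (suc n)
      b : Fin (suc (suc n)) → Carrier
      b i = unit top i - unit bottom i
      root : ∀ x → dot b (orbit x) ≈ 0#
      root x = begin
        dot b (orbit x)
          ≈⟨ dot-minusˡ (unit top) (unit bottom) (orbit x) ⟩
        dot (unit top) (orbit x) - dot (unit bottom) (orbit x)
          ≈⟨ +-cong (dot-unit top (orbit x)) (-‿cong (dot-unit bottom (orbit x))) ⟩
        iter τ (toℕ top) x - x
          ≡⟨ ≡.cong (λ i → iter τ i x - x) (Finₚ.toℕ-fromℕ (suc n)) ⟩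
        iter τ (suc n) x - x
          ≈⟨ ≈⇒-≈0 (τⁿ≈1 x) ⟩
        0# ∎

    orbits-independent : (b : Fin m → Carrier) → (∀ j → dot b (orbit (generator j)) ≈ 0#) → ∀ i → b i ≈ 0#
    orbits-independent b = orbit-vanish ℕₚ.≤-refl b generator generators-independent

    -- Interpolation: arbitrary values on the basis are taken by some Σ bᵢ τⁱ with m coefficients.
    -- The bound makes the right kernel of the matrix τⁱ(eⱼ) trivial, hence also the left one, which
    -- is what `fredholm` asks for.
    dualˡ : (y : Fin m → Carrier) → ∃ λ b → ∀ j → dot (orbit (generator j)) b ≈ y j
    dualˡ y = fredholm m M (λ {u} k → dot-zeroˡ (square-trivial-kernels M
      (λ b k → orbits-independent b (λ j → trans (dot-comm b (M j)) (k j))) u k))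
      where
      M : Fin m → Fin m → Carrier
      M j = orbit (generator j)

    -- For `y = unit zero` this produces the dual basis with respect to the trace: Σ βⱼ τⁱ(eⱼ) is 1
    -- for i = 0 and 0 for the other i < m.
    dualʳ : (y : Fin m → Carrier) → ∃ λ β → ∀ i → dot (λ j → orbit {m} (generator j) i) β ≈ y i
    dualʳ y = fredholm m (λ i j → orbit (generator j) i)
      (λ {u} k → dot-zeroˡ (orbits-independent u k))

    module _ (b : Fin m → Carrier) (eq : ∀ j → dot (orbit (generator j)) b ≈ iter τ m (generator j)) where

      -- Both sides are linear over the fixed field and agree on a basis, so τᵐ = Σ bᵢ τⁱ as
      -- operators on F.
      top : ∀ x → dot b (orbit x) ≈ iter τ m x
      top x = let (β , Sβ , x≈) = generators-span x in begin
        dot b (orbit x)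
          ≈⟨ dot-congˡ {f = b} (λ i → trans (iter-cong (toℕ i) x≈)
               (trans (iter-dot (toℕ i) β generator Sβ) (dot-comm β _))) ⟩
        dot b (λ i → dot (λ j → orbit (generator j) i) β)
          ≈⟨ dot-dot b (λ i j → orbit (generator j) i) β ⟩
        dot (λ j → dot b (orbit (generator j))) β
          ≈⟨ dot-congʳ (λ j → trans (dot-comm b _) (eq j)) ⟩
        dot (iter τ m ∘ generator) β
          ≈⟨ dot-comm _ β ⟩
        dot β (iter τ m ∘ generator)
          ≈⟨ iter-dot m β generator Sβ ⟨
        iter τ m (dot β generator)
          ≈⟨ iter-cong m x≈ ⟨
        iter τ m x ∎

      -- Dedekind's argument: subtracting τᵐ(y) times the relation at x from the relation at yx
      -- leaves Σ bᵢ (τⁱ y - τᵐ y) τⁱ x = 0 for all x. Its coefficients vanish by the bound, so τⁱ y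
      -- = τᵐ y wherever bᵢ ≠ 0.
      period : ∀ i → ¬ (b i ≈ 0#) → ∀ y → iter τ (m ℕ.∸ toℕ i) y ≈ y
      period i bᵢ≉0 y = iter-injective (toℕ i) (begin
        iter τ (toℕ i) (iter τ (m ℕ.∸ toℕ i) y)  ≡⟨ iter-+ (toℕ i) (m ℕ.∸ toℕ i) y ⟨
        iter τ (toℕ i ℕ.+ (m ℕ.∸ toℕ i)) y
          ≡⟨ ≡.cong (λ k → iter τ k y) (ℕₚ.m+[n∸m]≡n (ℕₚ.<⇒≤ (Finₚ.toℕ<n i))) ⟩
        iter τ m y                              ≈⟨ -≈0⇒≈ (*-cancel-≉0 bᵢ≉0 coefficient) ⟨
        iter τ (toℕ i) y                        ∎)
        where
        t = iter τ m y
        root : ∀ x → dot (λ i → b i * (orbit y i - t)) (orbit x) ≈ 0#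
        root x = begin
          dot (λ i → b i * (orbit y i - t)) (orbit x)
            ≈⟨ sum-cong-≋ (λ i → solve 4 (λ b o t x → b :* (o :- t) :* x := b :* (o :* x :- t :* x))
                 refl (b i) (orbit y i) t (orbit x i)) ⟩
          dot b (λ i → orbit y i * orbit x i - t * orbit x i)
            ≈⟨ dot-minusʳ b (λ i → orbit y i * orbit x i) (λ i → t * orbit x i) ⟩
          dot b (λ i → orbit y i * orbit x i) - dot b (λ i → t * orbit x i)
            ≈⟨ +-cong (dot-congˡ {f = b} (λ i → sym (iter-* (toℕ i) y x))) (-‿cong (dot-*ʳ t b (orbit x))) ⟩
          dot b (orbit (y * x)) - t * dot b (orbit x)
            ≈⟨ ≈⇒-≈0 (trans (top (y * x)) (trans (iter-* m y x) (*-congˡ (sym (top x))))) ⟩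
          0# ∎
        coefficient : b i * (orbit y i - iter τ m y) ≈ 0#
        coefficient = orbits-independent (λ i → b i * (orbit y i - iter τ m y)) (λ j → root (generator j)) i

      some-coefficient : ∃ λ i → ¬ (b i ≈ 0#)
      some-coefficient with Finₚ.any? (λ i → ¬? (b i ≟ 0#))
      ... | yes found = found
      ... | no none = ⊥-elim (0≉1 (begin
        0#              ≈⟨ dot-zeroˡ (λ i → decidable-stable (b i ≟ 0#) (λ b≉0 → none (i , b≉0))) ⟨
        dot b (orbit 1#) ≈⟨ top 1# ⟩
        iter τ m 1#     ≈⟨ iter-1 m ⟩
        1#              ∎))

    -- The period found is m - i for some i < m. As the degree m is at most any positive period, m ≤
    -- m - i, and the period is m itself.
    τ^degree≈1 : ∀ x → iter τ m x ≈ x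
    τ^degree≈1 =
      let (b , eq) = dualˡ (iter τ m ∘ generator)
          (i , bᵢ≉0) = some-coefficient b eq
          period′ = period b eq i bᵢ≉0
      in λ x → ≡.subst (λ k → iter τ k x ≈ x)
        (ℕₚ.≤-antisym (ℕₚ.m∸n≤m m (toℕ i)) (degree≤order (ℕₚ.m<n⇒0<n∸m (Finₚ.toℕ<n i)) period′))
        (period′ x)

-- Semilinear operators and their invariant vectors

module Semilinear {c ℓ} (F : Field c ℓ) where
  open Field F

  record IsSemilinear {d} (τ : Carrier → Carrier) (Ψ : (Fin d → Carrier) → Fin d → Carrier) : Set (c ⊔ ℓ) where
    field
      Ψ-cong : ∀ {v w} → (∀ k → v k ≈ w k) → ∀ k → Ψ v k ≈ Ψ w k
      Ψ-+    : ∀ v w k → Ψ (λ k → v k + w k) k ≈ Ψ v k + Ψ w k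
      Ψ-*    : ∀ t v k → Ψ (λ k → t * v k) k ≈ τ t * Ψ v k

module Descent {c ℓ} (F : Field c ℓ) {N} (size : Field.setoid F HasSize N)
               (τ : Field.Carrier F → Field.Carrier F) (isAut : FieldDefs.IsRingAut F τ)
               {d} (Ψ : (Fin d → Field.Carrier F) → Fin d → Field.Carrier F)
               (isSemilinear : Semilinear.IsSemilinear F τ Ψ) where
  open Field F hiding (zero)
  open Semilinear.IsSemilinear isSemilinear
  open FieldDefs F using (iter; IsRingAut)
  open IsRingAut isAut using () renaming (hom-1 to τ-1)
  open FieldProperties F
  open FiniteField F size
  open Twisted F size τ isAut
  open RingSolver commutativeRing
  open import Relation.Binary.Reasoning.Setoid setoid
  private variable m n r : ℕ

  Invariant : (Fin d → Carrier) → Set ℓ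
  Invariant w = ∀ k → Ψ w k ≈ w k

  Ψ-0 : ∀ k → Ψ (λ _ → 0#) k ≈ 0#
  Ψ-0 k = begin
    Ψ (λ _ → 0#) k         ≈⟨ Ψ-cong (λ _ → zeroˡ 0#) k ⟨
    Ψ (λ _ → 0# * 0#) k    ≈⟨ Ψ-* 0# (λ _ → 0#) k ⟩
    τ 0# * Ψ (λ _ → 0#) k  ≈⟨ trans (*-congʳ τ-0) (zeroˡ _) ⟩
    0#                     ∎

  Ψ-dot : (β : Fin r → Carrier) (e : Fin r → Fin d → Carrier) → ∀ k →
          Ψ (λ k → dot β (λ i → e i k)) k ≈ dot (τ ∘ β) (λ i → Ψ (e i) k)
  Ψ-dot {zero} β e k = Ψ-0 k
  Ψ-dot {suc r} β e k = trans (Ψ-+ _ _ k) (+-cong (Ψ-* (β zero) (e zero) k) (Ψ-dot (β ∘ suc) (e ∘ suc) k))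

  invariant-isSubspace : IsSubspace Fixed Invariant
  invariant-isSubspace = record
    { respᵛ = λ v≈w inv k → trans (Ψ-cong (sym ∘ v≈w) k) (trans (inv k) (v≈w k))
    ; 0ᵛ∈ = Ψ-0
    ; +ᵛ∈ = λ inv inv′ k → trans (Ψ-+ _ _ k) (+-cong (inv k) (inv′ k))
    ; *ᵛ∈ = λ St inv k → trans (Ψ-* _ _ k) (*-cong St (inv k)) }

  All : Carrier → Set
  All _ = ⊤

  -- Artin's argument: normalise a relation to have leading coefficient 1; the difference with
  -- its image under Ψ is a shorter relation, with coefficients τ γᵢ − γᵢ.
  fixed-independent⇒independent : (e : Fin r → Fin d → Carrier) → (∀ i → Invariant (e i)) →
                                  Independent Fixed e → Independent All e
  fixed-independent⇒independent {zero} e inv indep β _ eq = λ ()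
  fixed-independent⇒independent {suc r} e inv indep β _ eq with β zero ≟ 0#
  ... | yes β₀≈0 = λ { zero → β₀≈0 ; (suc i) → rest i }
    where
    rest = fixed-independent⇒independent (e ∘ suc) (inv ∘ suc)
      (λ γ Sγ eq i → indep (0# ∷ γ) (λ { zero → τ-0 ; (suc i) → Sγ i })
        (λ k → trans (+-congʳ (zeroˡ _)) (trans (+-identityˡ _) (eq k))) (suc i))
      (β ∘ suc) (λ _ → tt)
      (λ k → trans (sym (+-identityˡ _)) (trans (+-congʳ (sym (trans (*-congʳ β₀≈0) (zeroˡ _)))) (eq k)))
  ... | no β₀≉0 = ⊥-elim (0≉1 (sym (indep (1# ∷ γ) (λ { zero → τ-1 ; (suc i) → γ-fixed i })
                    (λ k → trans (+-congʳ (*-identityˡ _)) (relation k)) zero)))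
    where
    b = (β zero ⁻¹) β₀≉0
    γ : Fin r → Carrier
    γ i = b * β (suc i)
    relation : ∀ k → e zero k + dot γ (λ i → e (suc i) k) ≈ 0#
    relation k = begin
      e zero k + dot γ (λ i → e (suc i) k)
        ≈⟨ +-cong (sym (trans (*-congʳ (trans (*-comm b _) (⁻¹-inverse _ β₀≉0))) (*-identityˡ _)))
               (dot-*ˡ b (β ∘ suc) (λ i → e (suc i) k)) ⟩
      (b * β zero) * e zero k + b * dot (β ∘ suc) (λ i → e (suc i) k)
        ≈⟨ solve 4 (λ b β e s → (b :* β) :* e :+ b :* s := b :* (β :* e :+ s))
             refl b (β zero) (e zero k) _ ⟩
      b * dot β (λ i → e i k)
        ≈⟨ trans (*-congˡ (eq k)) (zeroʳ b) ⟩
      0# ∎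
    relationΨ : ∀ k → e zero k + dot (τ ∘ γ) (λ i → e (suc i) k) ≈ 0#
    relationΨ k = begin
      e zero k + dot (τ ∘ γ) (λ i → e (suc i) k)
        ≈⟨ +-cong (inv zero k) (trans (Ψ-dot γ (e ∘ suc) k) (dot-congˡ {f = τ ∘ γ} (λ i → inv (suc i) k))) ⟨
      Ψ (e zero) k + Ψ (λ k → dot γ (λ i → e (suc i) k)) k
        ≈⟨ Ψ-+ _ _ k ⟨
      Ψ (λ k → e zero k + dot γ (λ i → e (suc i) k)) k
        ≈⟨ trans (Ψ-cong relation k) (Ψ-0 k) ⟩
      0# ∎
    γ-fixed : ∀ i → Fixed (γ i)
    γ-fixed i = -≈0⇒≈ (fixed-independent⇒independent (e ∘ suc) (inv ∘ suc)
      (λ γ Sγ eq i → indep (0# ∷ γ) (λ { zero → τ-0 ; (suc i) → Sγ i })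
        (λ k → trans (+-congʳ (zeroˡ _)) (trans (+-identityˡ _) (eq k))) (suc i))
      (λ i → τ (γ i) - γ i) (λ _ → tt)
      (λ k → begin
        dot (λ i → τ (γ i) - γ i) (λ i → e (suc i) k)
          ≈⟨ dot-minusˡ (τ ∘ γ) γ (λ i → e (suc i) k) ⟩
        dot (τ ∘ γ) (λ i → e (suc i) k) - dot γ (λ i → e (suc i) k)
          ≈⟨ solve 3 (λ e a b → a :- b := (e :+ a) :- (e :+ b))
               refl (e zero k) (dot (τ ∘ γ) (λ i → e (suc i) k)) (dot γ (λ i → e (suc i) k)) ⟩
        (e zero k + dot (τ ∘ γ) (λ i → e (suc i) k)) - (e zero k + dot γ (λ i → e (suc i) k))
          ≈⟨ ≈⇒-≈0 (trans (relationΨ k) (sym (relation k))) ⟩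
        0# ∎) i)

  telescope : ∀ n (g : ℕ → Carrier) → sum {n} (λ i → g (suc (toℕ i))) + g 0 ≈ sum {n} (λ i → g (toℕ i)) + g n
  telescope zero g = refl
  telescope (suc n) g = begin
    (g 1 + sum {n} (λ i → g (suc (suc (toℕ i))))) + g 0
      ≈⟨ solve 3 (λ a b c → (a :+ b) :+ c := c :+ (b :+ a)) refl (g 1) _ (g 0) ⟩
    g 0 + (sum {n} (λ i → g (suc (suc (toℕ i)))) + g 1)
      ≈⟨ +-congˡ (telescope n (g ∘ suc)) ⟩
    g 0 + (sum {n} (λ i → g (suc (toℕ i))) + g (suc n))
      ≈⟨ +-assoc _ _ _ ⟨
    (g 0 + sum {n} (λ i → g (suc (toℕ i)))) + g (suc n) ∎

  module _ {n} (basis : Basis Fixed (Everything {1}) (suc n)) where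

    Periodic : (Fin d → Carrier) → Set ℓ
    Periodic w = ∀ k → fold w Ψ (suc n) k ≈ w k

    -- By semilinearity this is Σ Ψⁱ(x w), the sum of x w over one period of Ψ.
    trace : Carrier → (Fin d → Carrier) → Fin d → Carrier
    trace x w k = dot {suc n} (orbit x) (λ i → fold w Ψ (toℕ i) k)

    -- Ψ moves each term to the next one. The last wraps around to the first because both τ, on x,
    -- and Ψ, on w, return after n + 1 steps.
    trace-invariant : ∀ x {w} → Periodic w → Invariant (trace x w)
    trace-invariant x {w} per k = begin
      Ψ (trace x w) k
        ≈⟨ Ψ-dot {suc n} (orbit x) (λ i → fold w Ψ (toℕ i)) k ⟩
      sum {suc n} (λ i → g (suc (toℕ i)))
        ≈⟨ solve 2 (λ s z → s := (s :+ z) :- z) refl _ (g 0) ⟩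
      (sum {suc n} (λ i → g (suc (toℕ i))) + g 0) - g 0
        ≈⟨ +-cong (telescope (suc n) g) (-‿cong (sym (*-cong (τ^degree≈1 basis x) (per k)))) ⟩
      (sum {suc n} (λ i → g (toℕ i)) + g (suc n)) - g (suc n)
        ≈⟨ solve 2 (λ s z → (s :+ z) :- z := s) refl _ (g (suc n)) ⟩
      trace x w k ∎
      where
      g : ℕ → Carrier
      g i = iter τ i x * fold w Ψ i k

    invariant⇒periodic : ∀ {w} → Invariant w → ∀ i k → fold w Ψ i k ≈ w k
    invariant⇒periodic inv zero k = refl
    invariant⇒periodic inv (suc i) k = trans (Ψ-cong (invariant⇒periodic inv i) k) (inv k)

    -- Independence over F is Artin's argument above. For spanning, dual coefficients β recover w
    -- from invariant vectors: Σ βⱼ trace(eⱼ, w) = Σᵢ (Σⱼ βⱼ τⁱ eⱼ) Ψⁱ w, and only the term i = 0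
    -- survives, which is w.
    extend-scalars : Basis Fixed Invariant r → Basis All Periodic r
    extend-scalars B = record
      { vec = vec
      ; vec∈ = λ i → invariant⇒periodic (vec∈ i) (suc n)
      ; independent = fixed-independent⇒independent vec vec∈ independent
      ; spans = λ w per → let (β , eq) = dualʳ basis (unit zero) in spans-periodic β eq w per }
      where
      open Basis B
      open IsSubspace (span-isSubspace everything-isSubfield vec)
      span-all : ∀ {v} → InSpan Fixed vec v → InSpan All vec v
      span-all (β , _ , eq) = β , (λ _ → tt) , eq
      reconstruct : ∀ β → (∀ i → dot (λ j → orbit {suc n} (generator basis j) i) β ≈ unit zero i) → ∀ w k →
                    w k ≈ dot β (λ j → trace (generator basis j) w k)
      reconstruct β eq w k = sym (begin
        dot β (λ j → trace (generator basis j) w k)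
          ≈⟨ dot-dot β (λ j → orbit {suc n} (generator basis j)) (λ i → fold w Ψ (toℕ i) k) ⟩
        dot (λ i → dot β (λ j → orbit {suc n} (generator basis j) i)) (λ i → fold w Ψ (toℕ i) k)
          ≈⟨ dot-congʳ {h = λ i → fold w Ψ (toℕ i) k}
               (λ i → trans (dot-comm β (λ j → orbit {suc n} (generator basis j) i)) (eq i)) ⟩
        dot (unit {suc n} zero) (λ i → fold w Ψ (toℕ i) k)
          ≈⟨ dot-unit {suc n} zero (λ i → fold w Ψ (toℕ i) k) ⟩
        w k ∎)
      spans-periodic : ∀ β → (∀ i → dot (λ j → orbit {suc n} (generator basis j) i) β ≈ unit zero i) →
                       ∀ w → Periodic w →
                       InSpan All vec w
      spans-periodic β eq w per = respᵛ (λ k → sym (reconstruct β eq w k))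
        (dot∈ β (λ _ → tt) (λ j → trace (generator basis j) w)
          (λ j → span-all (spans (trace (generator basis j) w) (trace-invariant (generator basis j) per))))

-- The Frobenius automorphism

module Binomials where
  open import Data.Nat
  open import Data.Nat.Properties
  open import Data.Nat.Divisibility using (_∣_; m∣m*n; ∣⇒≤; >⇒∤)
  open import Data.Nat.DivMod using (_/_; m/n*n≡m)
  open import Data.Nat.Primality using (Prime; euclidsLemma)
  open import Data.Nat.Combinatorics using (_C_; k![n∸k]!∣n!)
  open import Data.Nat.Combinatorics.Specification using (nCk≡n!/k![n-k]!)

  prime∤! : ∀ {p} → Prime p → ∀ {k} → k < p → ¬ p ∣ k !
  prime∤! {p} p-prime {zero} 0<p p∣1 = <-irrefl ≡.refl (<-≤-trans (1<prime p-prime) (∣⇒≤ p∣1))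
    where
    1<prime : ∀ {p} → Prime p → 1 < p
    1<prime {suc (suc _)} _ = s≤s (s≤s z≤n)
  prime∤! p-prime {suc k} k<p p∣ with euclidsLemma (suc k) (k !) p-prime p∣
  ... | inj₁ p∣suc = >⇒∤ k<p p∣suc
  ... | inj₂ p∣k! = prime∤! p-prime (<-trans (n<1+n k) k<p) p∣k!

  -- The prime p divides p! = C · k! (p - k)!, but neither factorial, since both are products of
  -- numbers smaller than p.
  prime∣C : ∀ {p} → Prime p → ∀ {k} → 0 < k → k < p → p ∣ p C k
  prime∣C {p@(suc p-1)} p-prime {k} 0<k k<p
    with euclidsLemma (p C k) (k ! * (p ∸ k) !) p-prime (≡.subst (p ∣_) (≡.sym C*!≡!) (m∣m*n (p-1 !)))
    where
    instance _ = k !* (p ∸ k) !≢0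
    C*!≡! : (p C k) * (k ! * (p ∸ k) !) ≡ p !
    C*!≡! = ≡.trans (≡.cong (_* (k ! * (p ∸ k) !)) (nCk≡n!/k![n-k]! (<⇒≤ k<p)))
                     (m/n*n≡m (k![n∸k]!∣n! (<⇒≤ k<p)))
  ... | inj₁ p∣C = p∣C
  ... | inj₂ p∣!! with euclidsLemma (k !) ((p ∸ k) !) p-prime p∣!!
  ... | inj₁ p∣k! = ⊥-elim (prime∤! p-prime k<p p∣k!)
  ... | inj₂ p∣[p-k]! = ⊥-elim (prime∤! p-prime (∸-monoʳ-< 0<k (<⇒≤ k<p)) p∣[p-k]!)

module Frobenius {c ℓ} (F : Field c ℓ) {N} (size : Field.setoid F HasSize N) where
  open Field F hiding (zero)
  open FieldDefs F using (iter; pow; IsRingAut; InFq)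
  open FieldProperties F
  open FiniteField F size
  open RingSolver commutativeRing
  open import Algebra.Properties.Semiring.Mult semiring
    using (×-assoc-*; ×1-homo-*; ×-homo-1; ×-congʳ; ×-congˡ; ×-assocˡ)
    renaming (_×_ to _·_)
  open import Algebra.Properties.Semiring.Exp semiring using (_^_; ^-congˡ; ^-assocʳ)
  open import Algebra.Properties.CommutativeSemiring.Exp commutativeSemiring using (^-distrib-*)
  open import Algebra.Properties.CommutativeSemiring.Binomial commutativeSemiring as Binomial using (binomialTerm)
  import Algebra.Properties.CommutativeMonoid.Sum *-commutativeMonoid as Π
  open import Relation.Binary.Reasoning.Setoid setoid
  open import Data.Fin.Permutation using (Permutation)
  open import Data.Nat.Primality using (Prime; ¬prime[0]; prime⇒nonTrivial)
  open import Data.Nat.Divisibility using (_∣_; divides)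
  open import Data.Nat.Combinatorics using (_C_; nCn≡1)
  open Inverse size
  private variable m n r : ℕ

  bijection⇒permutation : (f g : Carrier → Carrier) → (∀ {x y} → x ≈ y → f x ≈ f y) →
                          (∀ {x y} → x ≈ y → g x ≈ g y) →
                          (∀ x → f (g x) ≈ x) → (∀ x → g (f x) ≈ x) → Permutation N N
  bijection⇒permutation f g f-cong g-cong fg gf =
    (Symm.inverse size ∘↔ mkInverse f g f-cong g-cong fg gf) ∘↔ size

  -- Translation by 1 permutes the field, so the sum of all elements does not change when 1 is added
  -- to each of its N terms.
  N·1≈0 : N · 1# ≈ 0#
  N·1≈0 = begin
    N · 1#                        ≈⟨ sum-replicate N ⟨
    sum (replicate N 1#)
      ≈⟨ solve 2 (λ s t → t := (s :+ t) :- s)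
           refl (sum from) (sum (replicate N 1#)) ⟩
    (sum from + sum (replicate N 1#)) - sum from
      ≈⟨ ≈⇒-≈0 (begin
        sum from + sum (replicate N 1#)         ≈⟨ ∑-distrib-+ from (replicate N 1#) ⟨
        sum (λ i → from i + 1#)                 ≈⟨ sum-cong-≋ (λ i → strictlyInverseʳ (from i + 1#)) ⟨
        sum (λ i → from (to (from i + 1#)))     ≈⟨ sum-permute from translation ⟨
        sum from                                ∎) ⟩
    0# ∎
    where
    translation : Permutation N N
    translation = bijection⇒permutation (_+ 1#) (_- 1#) +-congʳ +-congʳ
      (solve 2 (λ o x → (x :- o) :+ o := x) refl 1#) (solve 2 (λ o x → (x :+ o) :- o := x) refl 1#)

  prime-power-characteristic : ∀ {p} e → (p ℕ.^ e) · 1# ≈ 0# → p · 1# ≈ 0#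
  prime-power-characteristic zero eq = ⊥-elim (0≉1 (sym (trans (sym (+-identityʳ 1#)) eq)))
  prime-power-characteristic {p} (suc e) eq with p · 1# ≟ 0#
  ... | yes p≈0 = p≈0
  ... | no p≉0 = prime-power-characteristic {p} e
    (*-cancel-≉0 p≉0 (trans (sym (×1-homo-* p (p ℕ.^ e))) eq))

  pow≡^ : ∀ x n → pow x n ≡ x ^ n
  pow≡^ x zero = ≡.refl
  pow≡^ x (suc n) = ≡.cong (x *_) (pow≡^ x n)

  0^ : 1 ℕ.≤ n → 0# ^ n ≈ 0#
  0^ (s≤s _) = zeroˡ _

  1^ : ∀ n → 1# ^ n ≈ 1#
  1^ zero = refl
  1^ (suc n) = trans (*-identityˡ _) (1^ n)

  ^-≉0 : ∀ n {x} → ¬ (x ≈ 0#) → ¬ (x ^ n ≈ 0#)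
  ^-≉0 zero x≉0 eq = 0≉1 (sym eq)
  ^-≉0 (suc n) x≉0 eq = ^-≉0 n x≉0 (*-cancel-≉0 x≉0 eq)

  product-≉0 : (f : Fin n → Carrier) → (∀ i → ¬ (f i ≈ 0#)) → ¬ (Π.sum f ≈ 0#)
  product-≉0 {zero} f f≉0 eq = 0≉1 (sym eq)
  product-≉0 {suc n} f f≉0 eq = product-≉0 (f ∘ suc) (f≉0 ∘ suc) (*-cancel-≉0 (f≉0 zero) eq)

  -- The zero element is replaced by 1 in products over the whole field.
  atNonzero : Carrier → Carrier → Carrier
  atNonzero t y with y ≟ 0#
  ... | yes _ = 1#
  ... | no  _ = t

  atNonzero-0 : ∀ {t y} → y ≈ 0# → atNonzero t y ≈ 1#
  atNonzero-0 {t} {y} y≈0 with y ≟ 0#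
  ... | yes _ = refl
  ... | no y≉0 = ⊥-elim (y≉0 y≈0)

  atNonzero-≉0 : ∀ {t y} → ¬ (y ≈ 0#) → atNonzero t y ≈ t
  atNonzero-≉0 {t} {y} y≉0 with y ≟ 0#
  ... | yes y≈0 = ⊥-elim (y≉0 y≈0)
  ... | no _ = refl

  -- Scaling by a non-zero x permutes the field and fixes 0. Comparing the product of the non-zero
  -- elements before and after scaling shows that the product of one factor x per non-zero element
  -- is 1.
  fermat : ∀ x → x ^ N ≈ x
  fermat x with x ≟ 0#
  ... | yes x≈0 = trans (^-congˡ N x≈0) (trans (0^ (ℕ.>-nonZero⁻¹ N ⦃ N≢0 ⦄)) (sym x≈0))
  ... | no x≉0 = fermat≉0 N size
    where
    -- The size is made a variable so that it can be matched as `suc M`, with M the number of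
    -- non-zero elements.
    fermat≉0 : ∀ N → setoid HasSize N → x ^ N ≈ x
    fermat≉0 zero I = ⊥-elim (Finₚ.¬Fin0 (Inverse.to I 0#))
    fermat≉0 (suc M) I = trans (*-congˡ x^M≈1) (*-identityʳ x)
      where
      module I = Inverse I
      x⁻¹ = (x ⁻¹) x≉0
      cancel : ∀ y → x * (x⁻¹ * y) ≈ y
      cancel y = trans (sym (*-assoc _ _ _)) (trans (*-congʳ (⁻¹-inverse x x≉0)) (*-identityˡ y))
      cancel′ : ∀ y → x⁻¹ * (x * y) ≈ y
      cancel′ y = trans (solve 3 (λ i x y → i :* (x :* y) := x :* (i :* y)) refl x⁻¹ x y) (cancel y)
      scaling : Permutation (suc M) (suc M)
      scaling = (Symm.inverse I ∘↔ mkInverse (x *_) (x⁻¹ *_) *-congˡ *-congˡ cancel cancel′) ∘↔ I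
      g h : Fin (suc M) → Carrier
      g i = atNonzero (I.from i) (I.from i)
      h i = atNonzero x (I.from i)
      g-scaled : ∀ i → g (I.to (x * I.from i)) ≈ h i * g i
      g-scaled i with I.from i ≟ 0#
      ... | yes y≈0 = trans (atNonzero-0 (trans (I.strictlyInverseʳ _) (trans (*-congˡ y≈0) (zeroʳ x))))
                            (sym (*-identityˡ 1#))
      ... | no y≉0 = trans (atNonzero-≉0 (λ eq → y≉0 (*-cancel-≉0 x≉0 (trans (sym (I.strictlyInverseʳ _)) eq))))
                           (I.strictlyInverseʳ _)
      g≉0 : ∀ i → ¬ (g i ≈ 0#)
      g≉0 i eq with I.from i ≟ 0#
      ... | yes _ = 0≉1 (sym eq)
      ... | no y≉0 = y≉0 eq
      Πh≈1 : Π.sum h ≈ 1#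
      Πh≈1 = -≈0⇒≈ (*-cancel-≉0 (product-≉0 g g≉0) (begin
        Π.sum g * (Π.sum h - 1#)
          ≈⟨ solve 2 (λ g h → g :* (h :- :1) := h :* g :- g) refl (Π.sum g) (Π.sum h) ⟩
        Π.sum h * Π.sum g - Π.sum g
          ≈⟨ ≈⇒-≈0 (begin
            Π.sum h * Π.sum g                         ≈⟨ Π.∑-distrib-+ h g ⟨
            Π.sum (λ i → h i * g i)                   ≈⟨ Π.sum-cong-≋ g-scaled ⟨
            Π.sum (λ i → g (I.to (x * I.from i)))     ≈⟨ Π.sum-permute g scaling ⟨
            Π.sum g                                   ∎) ⟩
        0# ∎))
      z : Fin (suc M)
      z = I.to 0#
      x^M≈1 : x ^ M ≈ 1#
      x^M≈1 = begin
        x ^ M                                       ≈⟨ Π.sum-replicate M ⟨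
        Π.sum (replicate M x)                       ≈⟨ Π.sum-cong-≋ (λ i → atNonzero-≉0 (others i)) ⟨
        Π.sum (λ i → h (Fin.punchIn z i))           ≈⟨ *-identityˡ _ ⟨
        1# * Π.sum (λ i → h (Fin.punchIn z i))      ≈⟨ *-congʳ (atNonzero-0 (I.strictlyInverseʳ 0#)) ⟨
        h z * Π.sum (λ i → h (Fin.punchIn z i))     ≈⟨ Π.sum-remove h ⟨
        Π.sum h                                     ≈⟨ Πh≈1 ⟩
        1#                                          ∎
        where
        others : ∀ i → ¬ (I.from (Fin.punchIn z i) ≈ 0#)
        others i eq = Finₚ.punchInᵢ≢i z i (≡.trans (≡.sym (I.strictlyInverseˡ _)) (I.to-cong eq))

  module _ {p} (p-prime : Prime p) (p·1≈0 : p · 1# ≈ 0#) where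

    p∣⇒·≈0 : p ∣ n → ∀ x → n · x ≈ 0#
    p∣⇒·≈0 (divides k ≡.refl) x = begin
      (k ℕ.* p) · x     ≈⟨ ×-congˡ {x} (ℕₚ.*-comm k p) ⟩
      (p ℕ.* k) · x     ≈⟨ ×-assocˡ x p k ⟨
      p · (k · x)       ≈⟨ ×-congʳ p (*-identityˡ (k · x)) ⟨
      p · (1# * k · x)  ≈⟨ ×-assoc-* p 1# (k · x) ⟨
      p · 1# * k · x    ≈⟨ trans (*-congʳ p·1≈0) (zeroˡ _) ⟩
      0#                ∎

    -- In the binomial expansion every coefficient strictly between the two ends is divisible by p
    -- and therefore acts as 0.
    ^p-+ : ∀ x y → (x + y) ^ p ≈ x ^ p + y ^ p
    ^p-+ x y = by p ≡.refl
      where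
      by : ∀ m → m ≡ p → (x + y) ^ m ≈ x ^ m + y ^ m
      by zero ≡.refl = ⊥-elim (¬prime[0] p-prime)
      by (suc m) ≡.refl = begin
        (x + y) ^ suc m
          ≈⟨ Binomial.theorem (suc m) x y ⟩
        term zero + sum (λ i → term (suc i))
          ≈⟨ +-congˡ (sum-init-last (λ i → term (suc i))) ⟩
        term zero + (sum (λ i → term (suc (Fin.inject₁ i))) + term (suc (Fin.fromℕ m)))
          ≈⟨ +-cong first (+-cong (sum-zero middle) last) ⟩
        y ^ suc m + (0# + x ^ suc m)
          ≈⟨ solve 2 (λ x y → y :+ (:0 :+ x) := x :+ y) refl (x ^ suc m) (y ^ suc m) ⟩
        x ^ suc m + y ^ suc m ∎
        where
        term = binomialTerm x y (suc m)
        first : term zero ≈ y ^ suc m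
        first = trans (+-identityʳ _) (*-identityˡ _)
        last : term (suc (Fin.fromℕ m)) ≈ x ^ suc m
        last = begin
          term (suc (Fin.fromℕ m))
            ≡⟨ ≡.cong (λ k → (suc m C suc k) · (x ^ suc k * y ^ (m ℕ.∸ k))) (Finₚ.toℕ-fromℕ m) ⟩
          (suc m C suc m) · (x ^ suc m * y ^ (m ℕ.∸ m))
            ≈⟨ trans (×-congˡ (nCn≡1 (suc m))) (×-homo-1 _) ⟩
          x ^ suc m * y ^ (m ℕ.∸ m)
            ≡⟨ ≡.cong (λ k → x ^ suc m * y ^ k) (ℕₚ.n∸n≡0 m) ⟩
          x ^ suc m * 1#
            ≈⟨ *-identityʳ _ ⟩
          x ^ suc m ∎
        middle : ∀ i → term (suc (Fin.inject₁ i)) ≈ 0#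
        middle i = p∣⇒·≈0 (Binomials.prime∣C p-prime (s≤s z≤n)
          (s≤s (≡.subst (ℕ._< m) (≡.sym (Finₚ.toℕ-inject₁ i)) (Finₚ.toℕ<n i)))) _

    ^p^-+ : ∀ e x y → (x + y) ^ (p ℕ.^ e) ≈ x ^ (p ℕ.^ e) + y ^ (p ℕ.^ e)
    ^p^-+ zero x y = trans (*-identityʳ _) (sym (+-cong (*-identityʳ x) (*-identityʳ y)))
    ^p^-+ (suc e) x y = begin
      (x + y) ^ (p ℕ.* p ℕ.^ e)                        ≈⟨ ^-assocʳ (x + y) p (p ℕ.^ e) ⟨
      ((x + y) ^ p) ^ (p ℕ.^ e)                        ≈⟨ ^-congˡ (p ℕ.^ e) (^p-+ x y) ⟩
      (x ^ p + y ^ p) ^ (p ℕ.^ e)                      ≈⟨ ^p^-+ e (x ^ p) (y ^ p) ⟩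
      (x ^ p) ^ (p ℕ.^ e) + (y ^ p) ^ (p ℕ.^ e)
        ≈⟨ +-cong (^-assocʳ x p (p ℕ.^ e)) (^-assocʳ y p (p ℕ.^ e)) ⟩
      x ^ (p ℕ.* p ℕ.^ e) + y ^ (p ℕ.* p ℕ.^ e)        ∎

  -- Polynomials and the number of their roots

  Distinct : (Fin n → Carrier) → Set ℓ
  Distinct f = ∀ i j → f i ≈ f j → i ≡ j

  poly : (Fin n → Carrier) → Carrier → Carrier
  poly {zero}  b x = 0#
  poly {suc n} b x = b zero + x * poly (b ∘ suc) x

  -- Horner's scheme: quotient and remainder in the division by X - u.
  poly-divide : (Fin (suc n) → Carrier) → Carrier → (Fin n → Carrier) × Carrier
  poly-divide {zero}  b u = (λ ()) , b zero
  poly-divide {suc n} b u = let (Q , ρ) = poly-divide (b ∘ suc) u in (ρ ∷ Q) , b zero + u * ρ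

  poly-divide-correct : (b : Fin (suc n) → Carrier) (u x : Carrier) → let (Q , ρ) = poly-divide b u in
                        poly b x ≈ (x - u) * poly Q x + ρ
  poly-divide-correct {zero} b u x = solve 3 (λ b u x → b :+ x :* :0 := (x :- u) :* :0 :+ b)
       refl (b zero) u x
  poly-divide-correct {suc n} b u x = let (Q , ρ) = poly-divide (b ∘ suc) u in begin
    b zero + x * poly (b ∘ suc) x
      ≈⟨ +-congˡ (*-congˡ (poly-divide-correct (b ∘ suc) u x)) ⟩
    b zero + x * ((x - u) * poly Q x + ρ)
      ≈⟨ solve 5 (λ b x u p ρ → b :+ x :* ((x :- u) :* p :+ ρ) := (x :- u) :* (ρ :+ x :* p) :+ (b :+ u :* ρ))
           refl (b zero) x u (poly Q x) ρ ⟩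
    (x - u) * (ρ + x * poly Q x) + (b zero + u * ρ) ∎

  poly-divide-zero : (b : Fin (suc n) → Carrier) (u : Carrier) → let (Q , ρ) = poly-divide b u in
                     (∀ i → Q i ≈ 0#) → ρ ≈ 0# → ∀ i → b i ≈ 0#
  poly-divide-zero {zero} b u Q≈0 ρ≈0 zero = ρ≈0
  poly-divide-zero {suc n} b u Q≈0 ρ≈0 = λ
    { zero → trans (sym (+-identityʳ _)) (trans (+-congˡ (sym (trans (*-congˡ (Q≈0 zero)) (zeroʳ u)))) ρ≈0)
    ; (suc i) → poly-divide-zero (b ∘ suc) u (Q≈0 ∘ suc) (Q≈0 zero) i }

  -- Dividing by X - x₀ leaves remainder 0 and a quotient that has the remaining points as roots,
  -- because each xⱼ - x₀ is non-zero.
  poly-vanish : (b : Fin n → Carrier) (x : Fin n → Carrier) → Distinct x →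
                (∀ j → poly b (x j) ≈ 0#) → ∀ i → b i ≈ 0#
  poly-vanish {zero} b x distinct root = λ ()
  poly-vanish {suc n} b x distinct root = poly-divide-zero b u
    (poly-vanish Q (x ∘ suc) (λ i j eq → Finₚ.suc-injective (distinct (suc i) (suc j) eq)) root′) ρ≈0
    where
    u = x zero
    Q = proj₁ (poly-divide b u)
    ρ = proj₂ (poly-divide b u)
    ρ≈0 : ρ ≈ 0#
    ρ≈0 = begin
      ρ                         ≈⟨ solve 3 (λ ρ u p → ρ := (u :- u) :* p :+ ρ) refl ρ u (poly Q u) ⟩
      (u - u) * poly Q u + ρ    ≈⟨ poly-divide-correct b u u ⟨
      poly b u                  ≈⟨ root zero ⟩
      0#                        ∎
    root′ : ∀ j → poly Q (x (suc j)) ≈ 0#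
    root′ j = *-cancel-≉0 {x (suc j) - u} (λ eq → Finₚ.0≢1+n (distinct zero (suc j) (sym (-≈0⇒≈ eq)))) (begin
      (x (suc j) - u) * poly Q (x (suc j))      ≈⟨ +-identityʳ _ ⟨
      (x (suc j) - u) * poly Q (x (suc j)) + 0# ≈⟨ +-congˡ ρ≈0 ⟨
      (x (suc j) - u) * poly Q (x (suc j)) + ρ  ≈⟨ poly-divide-correct b u (x (suc j)) ⟨
      poly b (x (suc j))                        ≈⟨ root (suc j) ⟩
      0#                                        ∎)

  poly-unit : (i : Fin n) (x : Carrier) → poly (unit i) x ≈ x ^ toℕ i
  poly-unit {suc n} zero x = trans (+-congˡ (trans (*-congˡ (poly-0 n)) (zeroʳ x))) (+-identityʳ 1#)
    where
    poly-0 : ∀ n → poly {n} (λ _ → 0#) x ≈ 0#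
    poly-0 zero = refl
    poly-0 (suc n) = trans (+-identityˡ _) (trans (*-congˡ (poly-0 n)) (zeroʳ x))
  poly-unit {suc n} (suc i) x = trans (+-identityˡ _) (*-congˡ (poly-unit i x))

  poly-minus : (f g : Fin n → Carrier) (x : Carrier) → poly (λ i → f i - g i) x ≈ poly f x - poly g x
  poly-minus {zero} f g x = sym (-‿inverseʳ 0#)
  poly-minus {suc n} f g x = trans (+-congˡ (*-congˡ (poly-minus (f ∘ suc) (g ∘ suc) x)))
    (solve 5 (λ f g x p r → (f :- g) :+ x :* (p :- r) := (f :+ x :* p) :- (g :+ x :* r)) refl
      (f zero) (g zero) x (poly (f ∘ suc) x) (poly (g ∘ suc) x))

  -- With more than q such elements, the q + 1 coefficients of X^q - X would vanish. The coefficient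
  -- of X is -1, as q ≥ 2 keeps it apart from the leading one.
  fixed-by-power-≤ : ∀ {q} → 2 ℕ.≤ q → (x : Fin m → Carrier) → Distinct x → (∀ j → x j ^ q ≈ x j) → m ℕ.≤ q
  fixed-by-power-≤ {m} {q@(suc (suc _))} (s≤s (s≤s _)) x distinct fixed with m ℕₚ.≤? q
  ... | yes m≤q = m≤q
  ... | no m≰q = ⊥-elim (0≉1 (begin
      0#              ≈⟨ solve 0 (:0 := :- :0) refl ⟩
      - 0#            ≈⟨ -‿cong (poly-vanish b (x ∘ embed) distinct′ (λ j → root (embed j)) one) ⟨
      - (0# - 1#)     ≈⟨ solve 1 (λ x → :- (:0 :- x) := x) refl 1# ⟩
      1#              ∎))
    where
    one top : Fin (suc q)
    one = suc zero
    top = Fin.fromℕ q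
    b : Fin (suc q) → Carrier
    b i = unit top i - unit one i
    embed : Fin (suc q) → Fin m
    embed i = Fin.inject≤ i (ℕₚ.≰⇒> m≰q)
    distinct′ : Distinct (x ∘ embed)
    distinct′ i j eq = Finₚ.inject≤-injective _ _ i j (distinct (embed i) (embed j) eq)
    root : ∀ j → poly b (x j) ≈ 0#
    root j = begin
      poly b (x j)
        ≈⟨ poly-minus (unit top) (unit one) (x j) ⟩
      poly (unit top) (x j) - poly (unit one) (x j)
        ≈⟨ +-cong (poly-unit top (x j)) (-‿cong (poly-unit one (x j))) ⟩
      x j ^ toℕ top - x j * 1#
        ≡⟨ ≡.cong (λ k → x j ^ k - x j * 1#) (Finₚ.toℕ-fromℕ q) ⟩
      x j ^ q - x j * 1#
        ≈⟨ ≈⇒-≈0 (trans (fixed j) (sym (*-identityʳ (x j)))) ⟩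
      0# ∎

  module _ {p k n} (p-prime : Prime p) (1≤n : 1 ℕ.≤ n) (N≡ : N ≡ (p ℕ.^ suc k) ℕ.^ n) where
    private
      q = p ℕ.^ suc k

    p·1≈0 : p · 1# ≈ 0#
    p·1≈0 = prime-power-characteristic (suc k ℕ.* n)
      (trans (×-congˡ (≡.sym (≡.trans N≡ (ℕₚ.^-*-assoc p (suc k) n)))) N·1≈0)

    frobenius : Carrier → Carrier
    frobenius x = pow x q

    frobenius-^ : ∀ x → frobenius x ≈ x ^ q
    frobenius-^ x = reflexive (pow≡^ x q)

    iter-frobenius : ∀ i x → iter frobenius i x ≈ x ^ (q ℕ.^ i)
    iter-frobenius zero x = sym (*-identityʳ x)
    iter-frobenius (suc i) x = begin
      frobenius (iter frobenius i x)    ≈⟨ frobenius-^ _ ⟩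
      iter frobenius i x ^ q            ≈⟨ ^-congˡ q (iter-frobenius i x) ⟩
      (x ^ (q ℕ.^ i)) ^ q               ≈⟨ ^-assocʳ x (q ℕ.^ i) q ⟩
      x ^ (q ℕ.^ i ℕ.* q)               ≡⟨ ≡.cong (x ^_) (ℕₚ.*-comm (q ℕ.^ i) q) ⟩
      x ^ (q ℕ.^ suc i)                 ∎

    frobenius-period : ∀ x → iter frobenius n x ≈ x
    frobenius-period x = trans (iter-frobenius n x) (trans (reflexive (≡.cong (x ^_) (≡.sym N≡))) (fermat x))

    frobenius-cong : ∀ {x y} → x ≈ y → frobenius x ≈ frobenius y
    frobenius-cong {x} {y} eq = trans (frobenius-^ x) (trans (^-congˡ q eq) (sym (frobenius-^ y)))

    iter-frobenius-cong : ∀ i {x y} → x ≈ y → iter frobenius i x ≈ iter frobenius i y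
    iter-frobenius-cong zero eq = eq
    iter-frobenius-cong (suc i) eq = frobenius-cong (iter-frobenius-cong i eq)

    -- Bijectivity comes from finite order: since the n-th iterate is the identity by `fermat`, the
    -- iterate with exponent n - 1 is a two-sided inverse.
    frobenius-isAut : IsRingAut frobenius
    frobenius-isAut = record
      { cong = frobenius-cong
      ; hom-+ = λ x y → trans (frobenius-^ (x + y)) (trans (^p^-+ p-prime p·1≈0 (suc k) x y)
          (sym (+-cong (frobenius-^ x) (frobenius-^ y))))
      ; hom-* = λ x y → trans (frobenius-^ (x * y)) (trans (^-distrib-* x y q)
          (sym (*-cong (frobenius-^ x) (frobenius-^ y))))
      ; hom-1 = trans (frobenius-^ 1#) (1^ q)
      ; injective = λ {x} {y} eq → trans (sym (shifted x)) (trans (iter-frobenius-cong (ℕ.pred n) eq) (shifted y))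
      ; surjective = λ y → iter frobenius (ℕ.pred n) y ,
          trans (reflexive (≡.cong (λ i → iter frobenius i y) suc-pred)) (frobenius-period y) }
      where
      suc-pred : suc (ℕ.pred n) ≡ n
      suc-pred = ℕₚ.suc-pred n ⦃ ℕ.>-nonZero 1≤n ⦄
      shifted : ∀ x → iter frobenius (ℕ.pred n) (frobenius x) ≈ x
      shifted x = trans (reflexive (≡.trans (≡.sym (commute (ℕ.pred n) x))
                                            (≡.cong (λ i → iter frobenius i x) suc-pred)))
                        (frobenius-period x)
        where
        commute : ∀ i x → iter frobenius (suc i) x ≡ iter frobenius i (frobenius x)
        commute zero x = ≡.refl
        commute (suc i) x = ≡.cong frobenius (commute i x)

    2≤q : 2 ℕ.≤ q
    2≤q = ℕₚ.≤-trans 2≤p (ℕₚ.≤-trans (ℕₚ.≤-reflexive (≡.sym (ℕₚ.^-identityʳ p)))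
      (ℕₚ.^-monoʳ-≤ p ⦃ ℕ.>-nonZero (ℕₚ.<-trans (s≤s z≤n) 2≤p) ⦄ {1} {suc k} (s≤s z≤n)))
      where
      2≤p : 2 ℕ.≤ p
      2≤p = ℕ.nonTrivial⇒n>1 p ⦃ prime⇒nonTrivial p-prime ⦄

    -- Let s be the size and m the degree over the fixed field. Then s ≤ q by counting roots, and m
    -- ≤ n because Frobenius has period n. If s < q, then N = s ^ m ≤ s ^ n < q ^ n = N.
    fixed-frobenius-size : Restrict setoid (InFq q) HasSize q
    fixed-frobenius-size = ≡.subst (Restrict setoid (InFq q) HasSize_) s≡q I
      where
      open Twisted F size frobenius frobenius-isAut
      s = proj₁ fixed-size
      I = proj₂ fixed-size
      module I = Inverse I
      s≤q : s ℕ.≤ q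
      s≤q = fixed-by-power-≤ 2≤q (proj₁ ∘ I.from)
        (λ i j eq → ≡.trans (≡.sym (I.strictlyInverseˡ i)) (≡.trans (I.to-cong eq) (I.strictlyInverseˡ j)))
        (λ j → trans (sym (frobenius-^ _)) (proj₂ (I.from j)))
      s≢0 : ℕ.NonZero s
      s≢0 = ℕ.>-nonZero (ℕₚ.≤-<-trans z≤n (Finₚ.toℕ<n (I.to (0# , τ-0))))
      s≮q : ¬ (s ℕ.< q)
      s≮q s<q = ℕₚ.<-irrefl (≡.trans (fixed-size^degree I (proj₂ field-basis)) N≡)
        (ℕₚ.≤-<-trans (ℕₚ.^-monoʳ-≤ s ⦃ s≢0 ⦄ (degree≤order (proj₂ field-basis) 1≤n frobenius-period))
          (ℕₚ.^-monoˡ-< n ⦃ ℕ.>-nonZero 1≤n ⦄ s<q))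
      s≡q : s ≡ q
      s≡q = ℕₚ.≤-antisym s≤q (ℕₚ.≮⇒≥ s≮q)

-- Companion matrices

^-injective : ∀ {b} → 1 ℕ.< b → ∀ {m n} → b ℕ.^ m ≡ b ℕ.^ n → m ≡ n
^-injective {b} 1<b {m} {n} eq with ℕₚ.<-cmp m n
... | tri< m<n _ _ = ⊥-elim (ℕₚ.<-irrefl eq (ℕₚ.^-monoʳ-< b 1<b m<n))
... | tri≈ _ m≡n _ = m≡n
... | tri> _ _ n<m = ⊥-elim (ℕₚ.<-irrefl (≡.sym eq) (ℕₚ.^-monoʳ-< b 1<b n<m))

module Automorphisms {c ℓ} (F : Field c ℓ) {q n} (1<q : 1 ℕ.< q)
                     (size : Field.setoid F HasSize (q ℕ.^ n)) where
  open Field F hiding (zero)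
  open FieldDefs F using (IsRingAut; iter)
  open FieldProperties F
  open FiniteField F size

  module _ {τ : Carrier → Carrier} (isAut : IsRingAut τ) where
    open Twisted F size τ isAut

    -- For a basis of m elements over the fixed field, q ^ m and q ^ n both count F, so m = n.
    degree-n-basis : Restrict setoid Fixed HasSize q → Basis Fixed (Everything {1}) n
    degree-n-basis fixed-q = let (_ , B) = field-basis in
      ≡.subst (Basis Fixed Everything) (^-injective 1<q (fixed-size^degree fixed-q B)) B

    order-n : Restrict setoid Fixed HasSize q → ∀ x → iter τ n x ≈ x
    order-n fixed-q = τ^degree≈1 (degree-n-basis fixed-q)

    inverse : Carrier → Carrier
    inverse y = proj₁ (IsRingAut.surjective isAut y)

    τ-inverse : ∀ y → τ (inverse y) ≈ y
    τ-inverse y = proj₂ (IsRingAut.surjective isAut y)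

    inverse-isAut : IsRingAut inverse
    inverse-isAut = record
      { cong = λ {x} {y} eq → injective (trans (τ-inverse x) (trans eq (sym (τ-inverse y))))
      ; hom-+ = λ x y → injective (trans (τ-inverse (x + y))
          (sym (trans (hom-+ _ _) (+-cong (τ-inverse x) (τ-inverse y)))))
      ; hom-* = λ x y → injective (trans (τ-inverse (x * y))
          (sym (trans (hom-* _ _) (*-cong (τ-inverse x) (τ-inverse y)))))
      ; hom-1 = injective (trans (τ-inverse 1#) (sym hom-1))
      ; injective = λ {x} {y} eq → trans (sym (τ-inverse x)) (trans (cong eq) (τ-inverse y))
      ; surjective = λ x → τ x , injective (τ-inverse (τ x)) }
      where open IsRingAut isAut

    inverse-fixed : Inverse (Restrict setoid (Twisted.Fixed F size inverse inverse-isAut)) (Restrict setoid Fixed)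
    inverse-fixed = mkInverse
      (λ { (x , fix) → x , trans (cong (sym fix)) (τ-inverse x) })
      (λ { (x , fix) → x , injective (trans (τ-inverse x) (sym fix)) })
      (λ eq → eq) (λ eq → eq) (λ _ → refl) (λ _ → refl)
      where open IsRingAut isAut

module Companion {c ℓ} (F : Field c ℓ) {q n} (1<q : 1 ℕ.< q)
                 (size : Field.setoid F HasSize (q ℕ.^ suc n))
                 (σ : Field.Carrier F → Field.Carrier F) (isAut : FieldDefs.IsRingAut F σ)
                 (fixed-q : Restrict (Field.setoid F) (λ x → Field._≈_ F (σ x) x) HasSize q)
                 (a b c′ d : Field.Carrier F) (d≉0 : ¬ (Field._≈_ F d (Field.0# F))) where
  open Field F hiding (zero)
  open FieldDefs F
  open FieldProperties F
  open FiniteField F size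
  open Matrices F size
  open Automorphisms F {n = suc n} 1<q size
  open RingSolver commutativeRing
  open IsRingAut isAut using (injective) renaming (cong to σ-cong)
  open import Relation.Binary.Reasoning.Setoid setoid

  N : ℕ
  N = q ℕ.^ suc n

  τ : Carrier → Carrier
  τ = inverse isAut

  σ-τ : ∀ x → σ (τ x) ≈ x
  σ-τ = τ-inverse isAut

  module σ = Twisted F size σ isAut
  module τ = Twisted F size τ (inverse-isAut isAut)

  C A : Mat
  C = C-L a b c′ d d≉0
  A = A-L σ (suc n) a b c′ d d≉0

  sum3≈sum : ∀ f → sum3 f ≈ sum f
  sum3≈sum f = solve 3 (λ x y z → x :+ y :+ z := x :+ (y :+ (z :+ :0))) refl
    (f zero) (f (suc zero)) (f (suc (suc zero)))

  row : Vec3 → Mat → Vec3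
  row w M k = dot w (λ i → M i k)

  row-⊗ : ∀ w M M′ k → row w (M ⊗ M′) k ≈ row (row w M) M′ k
  row-⊗ w M M′ k = trans (dot-congˡ {f = w} (λ i → sum3≈sum (λ j → M i j * M′ j k)))
                         (dot-dot w M (λ j → M′ j k))

  row-I₃ : ∀ w k → row w I₃ k ≈ w k
  row-I₃ w zero = solve 3 (λ x y z → x :* :1 :+ (y :* :0 :+ (z :* :0 :+ :0)) := x) refl
    (w zero) (w (suc zero)) (w (suc (suc zero)))
  row-I₃ w (suc zero) = solve 3 (λ x y z → x :* :0 :+ (y :* :1 :+ (z :* :0 :+ :0)) := y) refl
    (w zero) (w (suc zero)) (w (suc (suc zero)))
  row-I₃ w (suc (suc zero)) = solve 3 (λ x y z → x :* :0 :+ (y :* :0 :+ (z :* :1 :+ :0)) := z) refl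
    (w zero) (w (suc zero)) (w (suc (suc zero)))

  I₃-column : ∀ v i → dot (I₃ i) v ≈ v i
  I₃-column v zero = solve 3 (λ x y z → :1 :* x :+ (:0 :* y :+ (:0 :* z :+ :0)) := x) refl
    (v zero) (v (suc zero)) (v (suc (suc zero)))
  I₃-column v (suc zero) = solve 3 (λ x y z → :0 :* x :+ (:1 :* y :+ (:0 :* z :+ :0)) := y) refl
    (v zero) (v (suc zero)) (v (suc (suc zero)))
  I₃-column v (suc (suc zero)) = solve 3 (λ x y z → :0 :* x :+ (:0 :* y :+ (:1 :* z :+ :0)) := z) refl
    (v zero) (v (suc zero)) (v (suc (suc zero)))

  Ψ : Vec3 → Vec3
  Ψ w k = τ (row w C k)

  Ψ-isSemilinear : Semilinear.IsSemilinear F τ Ψ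
  Ψ-isSemilinear = record
    { Ψ-cong = λ v≈w k → cong (dot-congʳ {h = λ i → C i k} v≈w)
    ; Ψ-+ = λ v w k → trans (cong (dot-+ˡ v w (λ i → C i k))) (hom-+ _ _)
    ; Ψ-* = λ t v k → trans (cong (dot-*ˡ t v (λ i → C i k))) (hom-* _ _) }
    where open IsRingAut (inverse-isAut isAut)

  open Descent F size τ (inverse-isAut isAut) Ψ Ψ-isSemilinear

  τ-basis : Basis τ.Fixed (τ.Everything {1}) (suc n)
  τ-basis = degree-n-basis (inverse-isAut isAut) (inverse-fixed isAut ∘↔ fixed-q)

  -- The start index `i` is general and the row carries the twist σⁱ, which lets the induction
  -- absorb one factor at a time: σⁱ(x) σⁱ(C) = σⁱ(x C) = σⁱ⁺¹(Ψ x).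
  row-prodFrom : ∀ i k x j → row (λ l → iter σ i (x l)) (prodFrom σ C i k) j ≈ iter σ (i ℕ.+ k) (fold x Ψ k j)
  row-prodFrom i zero x j = trans (row-I₃ (λ l → iter σ i (x l)) j)
    (reflexive (≡.cong (λ m → iter σ m (x j)) (≡.sym (ℕₚ.+-identityʳ i))))
  row-prodFrom i (suc k) x j = begin
    row (λ l → iter σ i (x l)) (mapMat (iter σ i) C ⊗ prodFrom σ C (suc i) k) j
      ≈⟨ row-⊗ (λ l → iter σ i (x l)) (mapMat (iter σ i) C) (prodFrom σ C (suc i) k) j ⟩
    row (row (λ l → iter σ i (x l)) (mapMat (iter σ i) C)) (prodFrom σ C (suc i) k) j
      ≈⟨ dot-congʳ {h = λ l → prodFrom σ C (suc i) k l j} step ⟩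
    row (λ l → iter σ (suc i) (Ψ x l)) (prodFrom σ C (suc i) k) j
      ≈⟨ row-prodFrom (suc i) k (Ψ x) j ⟩
    iter σ (suc (i ℕ.+ k)) (fold (Ψ x) Ψ k j)
      ≡⟨ ≡.cong₂ (iter σ) (≡.sym (ℕₚ.+-suc i k)) (≡.cong (λ f → f j) (fold-Ψ k)) ⟩
    iter σ (i ℕ.+ suc k) (Ψ (fold x Ψ k) j) ∎
    where
    fold-Ψ : ∀ k → fold (Ψ x) Ψ k ≡ Ψ (fold x Ψ k)
    fold-Ψ zero = ≡.refl
    fold-Ψ (suc k) = ≡.cong Ψ (fold-Ψ k)
    step : ∀ l → row (λ l → iter σ i (x l)) (mapMat (iter σ i) C) l ≈ iter σ (suc i) (Ψ x l)
    step l = begin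
      dot (λ m → iter σ i (x m)) (λ m → iter σ i (C m l))  ≈⟨ σ.iter-dot-* i x (λ m → C m l) ⟨
      iter σ i (row x C l)                                  ≈⟨ σ.iter-cong i (σ-τ _) ⟨
      iter σ i (σ (Ψ x l))                                  ≡⟨ σ.iter-suc i (Ψ x l) ⟨
      iter σ (suc i) (Ψ x l)                                ∎

  row-A : ∀ w k → row w A k ≈ fold w Ψ (suc n) k
  row-A w k = trans (row-prodFrom 0 (suc n) w k) (order-n isAut fixed-q _)

  A-I : Fin 3 → Fin 3 → Carrier
  A-I i j = A i j - I₃ i j

  left-eigen : ∀ w j → dot w (λ i → A-I i j) ≈ row w A j - w j
  left-eigen w j = trans (dot-minusʳ w (λ i → A i j) (λ i → I₃ i j)) (+-congˡ (-‿cong (row-I₃ w j)))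

  right-eigen : ∀ v i → dot (A-I i) v ≈ apply A v i - v i
  right-eigen v i = trans (dot-minusˡ (A i) (I₃ i) v)
    (+-cong (sym (sum3≈sum (λ k → A i k * v k))) (-‿cong (I₃-column v i)))

  everything-size : Restrict setoid All HasSize N
  everything-size = mkInverse {T = setoid} proj₁ (_, tt) (λ eq → eq) (λ eq → eq) (λ _ → refl) (λ _ → refl) ∘↔ size

  Root : Carrier → Set ℓ
  Root x = Lpoly σ a b c′ d x ≈ 0#

  -- Invariance under Ψ means w C = σ(w). The first two columns of C are shifts and force w = (x, σ
  -- x, σ² x); the third column then says L(x) = 0 divided by d.
  roots : Inverse (Restrict setoid Root) (Restrict (≋-setoid setoid 3) Invariant)
  roots = mkInverse
    (λ { (x , root) → vector x , vector-invariant x root })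
    (λ { (w , inv) → w zero , invariant-root w inv })
    (λ eq → λ { zero → eq ; (suc zero) → σ-cong eq ; (suc (suc zero)) → σ-cong (σ-cong eq) })
    (λ eq → eq zero)
    (λ { (w , inv) zero → refl
       ; (w , inv) (suc zero) → first w inv
       ; (w , inv) (suc (suc zero)) → trans (σ-cong (first w inv)) (second w inv) })
    (λ _ → refl)
    where
    d⁻¹ = (d ⁻¹) d≉0
    vector : Carrier → Vec3
    vector x zero = x
    vector x (suc zero) = σ x
    vector x (suc (suc zero)) = σ (σ x)
    rowC-0 : ∀ w → row w C zero ≈ w (suc zero)
    rowC-0 w = solve 3 (λ x y z → x :* :0 :+ (y :* :1 :+ (z :* :0 :+ :0)) := y) refl
      (w zero) (w (suc zero)) (w (suc (suc zero)))
    rowC-1 : ∀ w → row w C (suc zero) ≈ w (suc (suc zero))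
    rowC-1 w = solve 3 (λ x y z → x :* :0 :+ (y :* :0 :+ (z :* :1 :+ :0)) := z) refl
      (w zero) (w (suc zero)) (w (suc (suc zero)))
    -- Multiplication by `d` clears the denominators of the last column. For w = (x, σ x, σ² x) and
    -- t = σ³ x the right side is L(x).
    rowC-2 : ∀ w t → d * (t - row w C (suc (suc zero)))
                     ≈ a * w zero + b * w (suc zero) + c′ * w (suc (suc zero)) + d * t
    rowC-2 w t = begin
      d * (t - row w C (suc (suc zero)))
        ≈⟨ solve 9 (λ a b c d e x y z t →
             d :* (t :- (x :* (:- (a :* e)) :+ (y :* (:- (b :* e)) :+ (z :* (:- (c :* e)) :+ :0))))
             := (d :* e) :* (a :* x :+ b :* y :+ c :* z) :+ d :* t) refl
             a b c′ d d⁻¹ (w zero) (w (suc zero)) (w (suc (suc zero))) t ⟩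
      (d * d⁻¹) * (a * w zero + b * w (suc zero) + c′ * w (suc (suc zero))) + d * t
        ≈⟨ +-congʳ (trans (*-congʳ (⁻¹-inverse d d≉0)) (*-identityˡ _)) ⟩
      a * w zero + b * w (suc zero) + c′ * w (suc (suc zero)) + d * t ∎
    to-invariant : ∀ w k → row w C k ≈ σ (w k) → Ψ w k ≈ w k
    to-invariant w k eq = injective (trans (σ-τ _) eq)
    from-invariant : ∀ w → Invariant w → ∀ k → row w C k ≈ σ (w k)
    from-invariant w inv k = trans (sym (σ-τ _)) (σ-cong (inv k))
    vector-invariant : ∀ x → Root x → Invariant (vector x)
    vector-invariant x root zero = to-invariant (vector x) zero (rowC-0 (vector x))
    vector-invariant x root (suc zero) = to-invariant (vector x) (suc zero) (rowC-1 (vector x))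
    vector-invariant x root (suc (suc zero)) = to-invariant (vector x) (suc (suc zero))
      (sym (-≈0⇒≈ (*-cancel-≉0 d≉0 (trans (rowC-2 (vector x) _) root))))
    first : ∀ w → Invariant w → σ (w zero) ≈ w (suc zero)
    first w inv = trans (sym (from-invariant w inv zero)) (rowC-0 w)
    second : ∀ w → Invariant w → σ (w (suc zero)) ≈ w (suc (suc zero))
    second w inv = trans (sym (from-invariant w inv (suc zero))) (rowC-1 w)
    invariant-root : ∀ w → Invariant w → Root (w zero)
    invariant-root w inv = begin
      a * w zero + b * σ (w zero) + c′ * σ (σ (w zero)) + d * σ (σ (σ (w zero)))
        ≈⟨ +-cong (+-cong (+-congˡ (*-congˡ (first w inv))) (*-congˡ σσ)) (*-congˡ (σ-cong σσ)) ⟩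
      a * w zero + b * w (suc zero) + c′ * w (suc (suc zero)) + d * σ (w (suc (suc zero)))
        ≈⟨ rowC-2 w _ ⟨
      d * (σ (w (suc (suc zero))) - row w C (suc (suc zero)))
        ≈⟨ trans (*-congˡ (≈⇒-≈0 (sym (from-invariant w inv (suc (suc zero)))))) (zeroʳ d) ⟩
      0# ∎
      where
      σσ : σ (σ (w zero)) ≈ w (suc (suc zero))
      σσ = trans (σ-cong (first w inv)) (second w inv)

  invariant-basis : ∃ (Basis τ.Fixed Invariant)
  invariant-basis = basis-exists τ.fixed-isSubfield τ.fixed? (IsSubspace.respᵛ invariant-isSubspace)
    (λ w → Finₚ.all? (λ k → Ψ w k ≟ w k))

  dimension : ℕ
  dimension = proj₁ invariant-basis

  roots-size : Restrict setoid Root HasSize (q ℕ.^ dimension)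
  roots-size = roots ∘↔ basis-size τ.fixed-isSubfield invariant-isSubspace
    (inverse-fixed isAut ∘↔ fixed-q) (proj₂ invariant-basis)

  -- By `row-A` this kernel consists of the periodic vectors, for which descent provides a basis
  -- over F with as many elements as the basis of the invariant vectors over the fixed field. So the
  -- exponent is that of the root count, with base `N` instead of `q`.
  left-kernel-size : Restrict (≋-setoid setoid 3) (LeftKernel A-I) HasSize (N ℕ.^ dimension)
  left-kernel-size = basis-size everything-isSubfield left-isSubspace everything-size record
    { vec = vec
    ; vec∈ = λ i → periodic⇒left (vec∈ i)
    ; independent = independent
    ; spans = λ w k → spans w (λ j → trans (sym (row-A w j)) (-≈0⇒≈ (trans (sym (left-eigen w j)) (k j)))) }
    where
    open Basis (extend-scalars τ-basis (proj₂ invariant-basis))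
    periodic⇒left : ∀ {w} → Periodic τ-basis w → LeftKernel A-I w
    periodic⇒left {w} per j = trans (left-eigen w j) (≈⇒-≈0 (trans (row-A w j) (per j)))
    left-isSubspace : IsSubspace All (LeftKernel A-I)
    left-isSubspace = record
      { respᵛ = λ v≈w k j → trans (sym (dot-congʳ {h = λ i → A-I i j} v≈w)) (k j)
      ; 0ᵛ∈ = λ j → dot-zeroˡ {g = λ i → A-I i j} (λ _ → refl)
      ; +ᵛ∈ = λ {v} {w} k k′ j → trans (dot-+ˡ v w (λ i → A-I i j)) (trans (+-cong (k j) (k′ j)) (+-identityˡ 0#))
      ; *ᵛ∈ = λ {t} {v} _ k j → trans (dot-*ˡ t v (λ i → A-I i j)) (trans (*-congˡ (k j)) (zeroʳ t)) }

  right-isSubspace : IsSubspace All (RightKernel A-I)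
  right-isSubspace = record
    { respᵛ = λ v≈w k i → trans (sym (dot-congˡ {f = A-I i} v≈w)) (k i)
    ; 0ᵛ∈ = λ i → sum-zero (λ j → zeroʳ (A-I i j))
    ; +ᵛ∈ = λ {v} {w} k k′ i → trans (dot-+ʳ (A-I i) v w) (trans (+-cong (k i) (k′ i)) (+-identityˡ 0#))
    ; *ᵛ∈ = λ {t} {v} _ k i → trans (dot-*ʳ t (A-I i) v) (trans (*-congˡ (k i)) (zeroʳ t)) }

  -- `A-I` is square, so the factor N ^ 3 cancels in `kernel-sizes` and leaves N ^ g = N ^
  -- `dimension`.
  right-kernel-dimension : ∀ {g} → Basis All (RightKernel A-I) g → g ≡ dimension
  right-kernel-dimension B = ^-injective 1<N
    (ℕₚ.*-cancelʳ-≡ _ _ (N ℕ.^ 3) ⦃ ℕₚ.m^n≢0 N 3 ⦃ N≢0 ⦄ ⦄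
      (kernel-sizes 3 A-I (basis-size everything-isSubfield right-isSubspace everything-size B) left-kernel-size))
    where
    1<N : 1 ℕ.< N
    1<N = ℕₚ.^-monoʳ-< q 1<q {0} {suc n} (s≤s z≤n)

  lincomb≡dot : ∀ g (β : Fin g → Carrier) (vs : Fin g → Vec3) k → lincomb g β vs k ≡ dot β (λ i → vs i k)
  lincomb≡dot zero β vs k = ≡.refl
  lincomb≡dot (suc g) β vs k = ≡.cong (β zero * vs zero k +_) (lincomb≡dot g (β ∘ suc) (vs ∘ suc) k)

  basis⇒GeomMult1 : ∀ {g} → Basis All (RightKernel A-I) g → GeomMult1 A g
  basis⇒GeomMult1 {g} B = vec
    , (λ i k → -≈0⇒≈ (trans (sym (right-eigen (vec i) k)) (vec∈ i k)))
    , (λ β eq → independent β (λ _ → tt) (λ k → trans (reflexive (≡.sym (lincomb≡dot g β vec k))) (eq k)))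
    , λ v eig → let (β , _ , eq) = spans v (λ i → trans (right-eigen v i) (≈⇒-≈0 (eig i))) in
        β , λ k → trans (eq k) (reflexive (≡.sym (lincomb≡dot g β vec k)))
    where open Basis B

  GeomMult1⇒basis : ∀ {g} → GeomMult1 A g → Basis All (RightKernel A-I) g
  GeomMult1⇒basis {g} (vs , eig , indep , span) = record
    { vec = vs
    ; vec∈ = λ j i → trans (right-eigen (vs j) i) (≈⇒-≈0 (eig j i))
    ; independent = λ β _ eq → indep β (λ k → trans (reflexive (lincomb≡dot g β vs k)) (eq k))
    ; spans = λ v k → let (β , eq) = span v (λ i → -≈0⇒≈ (trans (sym (right-eigen v i)) (k i))) in
        β , (λ _ → tt) , λ i → trans (eq i) (reflexive (lincomb≡dot g β vs i)) }

  geometric-multiplicity : GeomMult1 A dimension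
  geometric-multiplicity =
    let (_ , B) = basis-exists {P = RightKernel A-I} everything-isSubfield (λ _ → yes tt)
                    (IsSubspace.respᵛ right-isSubspace)
                    (λ v → Finₚ.all? (λ i → dot (A-I i) v ≟ 0#))
    in ≡.subst (GeomMult1 A) (right-kernel-dimension B) (basis⇒GeomMult1 B)

  -- Each side amounts to g = `dimension`: the root count because q ^ g determines g, the
  -- multiplicity because a basis of g eigenvectors determines the size of the right kernel.
  root-count⇔multiplicity : ∀ g → HasExactly Root (q ℕ.^ g) ⇔ GeomMult1 A g
  root-count⇔multiplicity g = mk⇔
    (λ exactly → ≡.subst (GeomMult1 A)
      (^-injective 1<q (size-unique roots-size (HasExactly⇒size F exactly))) geometric-multiplicity)
    (λ mult → ≡.subst (λ r → HasExactly Root (q ℕ.^ r)) (≡.sym (right-kernel-dimension (GeomMult1⇒basis mult)))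
      (size⇒HasExactly F roots-size))

open import Data.Nat using (_≤_; _^_)

theorem13 : ∀ {c ℓ} (F : Field c ℓ) (q n : ℕ) → IsPrimePower q → 1 ≤ n →
    FieldDefs.HasExactly F {ℓ} (λ _ → ⊤) (q ^ n) →
    (σ : Field.Carrier F → Field.Carrier F) → FieldDefs.IsGalGenerator F q σ →
    (a b c d : Field.Carrier F) → (d≉0 : ¬ (Field._≈_ F d (Field.0# F))) →
    ¬ (Field._≈_ F a (Field.0# F)) →
    (g : ℕ) → g ≤ 3 →
    (FieldDefs.HasExactly F (λ x → Field._≈_ F (FieldDefs.Lpoly F σ a b c d x) (Field.0# F)) (q ^ g)
    ⇔ FieldDefs.GeomMult1 F (FieldDefs.A-L F σ n a b c d d≉0) g)
theorem13 F _ (suc n) (p , k , p-prime , ≡.refl) 1≤n exactly σ galois a b c d d≉0 _ g _ =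
  Companion.root-count⇔multiplicity F {n = n} (2≤q {k = k} p-prime 1≤n ≡.refl) size σ aut fixed-q a b c d d≉0 g
  where
  open Field F hiding (zero)
  open FieldDefs.IsGalGenerator galois
  open FieldDefs.InGal inGal
  size : setoid HasSize ((p ^ suc k) ^ suc n)
  size = mkInverse {T = Restrict setoid (λ _ → ⊤)} (λ x → x , _) proj₁
           (λ eq → eq) (λ eq → eq) (λ _ → refl) (λ _ → refl)
    ∘↔ HasExactly⇒size F exactly
  open Frobenius F size
  open FieldDefs F using (iter; InFq)
  fixed-by-iter : ∀ i {x} → σ x ≈ x → iter σ i x ≈ x
  fixed-by-iter zero fix = refl
  fixed-by-iter (suc i) fix = trans (FieldDefs.IsRingAut.cong aut (fixed-by-iter i fix)) fix
  -- The generator property is applied to Frobenius, which fixes F_q by the very definition of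
  -- `InFq`.
  frobenius-power : ∃ λ i → ∀ x → frobenius {k = k} p-prime 1≤n ≡.refl x ≈ iter σ i x
  frobenius-power = generates (frobenius {k = k} p-prime 1≤n ≡.refl)
    record { aut = frobenius-isAut {k = k} p-prime 1≤n ≡.refl ; fixes = λ _ fix → fix }
  -- Fix σ = F_q: an element fixed by σ is fixed by Frobenius, a power of σ, and the converse is
  -- part of σ being in the Galois group.
  fixed-q : Restrict setoid (λ x → σ x ≈ x) HasSize (p ^ suc k)
  fixed-q = mkInverse {T = Restrict setoid (InFq (p ^ suc k))}
      (λ { (x , fix) → x , trans (proj₂ frobenius-power x) (fixed-by-iter (proj₁ frobenius-power) fix) })
      (λ { (x , fix) → x , fixes x fix })
      (λ eq → eq) (λ eq → eq) (λ _ → refl) (λ _ → refl)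
    ∘↔ fixed-frobenius-size {k = k} p-prime 1≤n ≡.refl
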